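{- Let $2\le k\le n-2$ and let $T\in\mathfrak{T}_{n,k}$, i.e. $T$ is a tree on $n$ vertices with exactly $k$ pendant vertices. Then $W(T_{n,k})\le W(T)$, and equality holds if and only if $T=T_{n,k}$.
   Context: Equality of graphs means isomorphism. The Wiener index of a connected graph $G$ is $W(G)=\sum_{\{u,v\}\subseteq V(G)}d_G(u,v)$, where the sum is over unordered pairs of vertices and $d_G$ is the shortest-path distance. A pendant vertex is a vertex of degree one. $\mathfrak{T}_{n,k}$ is the class of all trees on $n$ vertices with exactly $k$ pendant vertices. $P_m$ denotes the path on $m$ vertices. $T_{n,k}\in\mathfrak{T}_{n,k}$ is the tree that has a vertex $v$ of degree $k$ such that $T_{n,k}\setminus v = rP_{q+1}\cup (k-r)P_q$ (a disjoint union of $r$ copies of $P_{q+1}$ and $k-r$ copies of $P_q$), where $q=\lfloor\frac{n-1}{k}\rfloor$ and $r=n-1-kq$, so $0\le r<k$. -}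

module Defs where

open import Data.Bool.Base using (if_then_else_)
open import Data.Empty using (⊥-elim)
open import Data.Fin.Base
  using (Fin; zero; suc; toℕ; fromℕ<; punchIn; splitAt; join; remQuot; combine)
open import Data.Fin.Permutation using (Permutation; permutation; _⟨$⟩ʳ_)
import Data.Fin.Properties as Fin
open import Data.List.Base
  using (List; []; _∷_; length; filter; allFin; tabulate)
open import Data.List.Membership.Propositional using (_∈_)
open import Data.List.Membership.Propositional.Properties
  using (∈-filter⁺; ∈-filter⁻; ∈-tabulate⁺; ∈-tabulate⁻; ∈-allFin)
open import Data.List.Membership.Propositional.Properties.WithK
  using (unique∧set⇒bag)
import Data.List.Properties as List
open import Data.List.Relation.Binary.BagAndSetEquality using (∼bag⇒↭)
open import Data.List.Relation.Binary.Permutation.Propositional.Properties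
  using (↭-length)
import Data.List.Relation.Unary.All as All
open import Data.List.Relation.Unary.AllPairs using ([]; _∷_)
open import Data.List.Relation.Unary.Any using (here; there)
open import Data.List.Relation.Unary.Unique.Propositional using (Unique)
import Data.List.Relation.Unary.Unique.Propositional.Properties as Uniq
open import Data.Nat
open import Data.Nat.DivMod
open import Data.Nat.Induction using (<-rec)
import Data.Nat.Properties as ℕ
open import Data.Product using (Σ; ∃; _×_; _,_; proj₁; proj₂)
open import Data.Sum.Base using (_⊎_; inj₁; inj₂; swap)
open import Data.Sum.Relation.Binary.Pointwise
  using (Pointwise; ⊎-symmetric; ⊎-decidable; inj₁; inj₂)
open import Function.Bundles using (_⇔_; mk⇔; Equivalence)
open import Level using (0ℓ)
open import Relation.Binary.Core using (Rel)
open import Relation.Binary.Definitions using (Symmetric; Decidable)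
open import Relation.Binary.PropositionalEquality
  using (_≡_; refl; sym; trans; cong; cong₂; subst; subst₂; module ≡-Reasoning)
open import Relation.Nullary using (¬_; Dec; yes; no; does)
open import Relation.Nullary.Decidable using (map′; _×-dec_; _⊎-dec_)
open import Algebra.Properties.CommutativeMonoid.Sum ℕ.+-0-commutativeMonoid
  using (sum-syntax)

record Graph (n : ℕ) : Set₁ where
  infix 4 _~_ _~?_
  field
    _~_    : Rel (Fin n) 0ℓ
    _~?_   : Decidable _~_
    ~-sym  : Symmetric _~_
    ~-irr  : ∀ {v} → ¬ (v ~ v)

open Graph using () renaming (_~_ to Adj; _~?_ to Adj?)

infix 4 _≅_

-- A bijection between the vertex sets forces m ≡ n.
record _≅_ {m n : ℕ} (G : Graph m) (H : Graph n) : Set where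
  field
    bijection : Permutation m n
    adjacency : ∀ u v → Adj G u v ⇔ Adj H (bijection ⟨$⟩ʳ u) (bijection ⟨$⟩ʳ v)

degree : ∀ {n} → Graph n → Fin n → ℕ
degree {n} G v = length (filter (Adj? G v) (allFin n))

pendants : ∀ {n} → Graph n → List (Fin n)
pendants {n} G = filter (λ v → degree G v ≟ 1) (allFin n)

infixr 5 _∷_

data Walk {n} (G : Graph n) : Fin n → Fin n → ℕ → Set where
  []  : ∀ {u} → Walk G u u 0
  _∷_ : ∀ {u w v ℓ} → Adj G u w → Walk G w v ℓ → Walk G u v (suc ℓ)

vertices : ∀ {n} {G : Graph n} {u v ℓ} → Walk G u v ℓ → List (Fin n)
vertices {u = u} []      = u ∷ []
vertices {u = u} (_ ∷ w) = u ∷ vertices w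

Connected : ∀ {n} → Graph n → Set
Connected G = ∀ u v → ∃ λ ℓ → Walk G u v ℓ

-- A cycle is a path with at least three vertices whose end vertices are
-- adjacent.
Acyclic : ∀ {n} → Graph n → Set
Acyclic G = ∀ {u v ℓ} (p : Walk G u v ℓ) → Unique (vertices p) → 2 ≤ ℓ →
            ¬ Adj G v u

walk? : ∀ {n} (G : Graph n) u v ℓ → Dec (Walk G u v ℓ)
walk? G u v zero = map′ (λ { refl → [] }) (λ { [] → refl }) (u Fin.≟ v)
walk? G u v (suc ℓ) =
  map′ (λ { (_ , a , p) → a ∷ p }) (λ { (a ∷ p) → _ , a , p })
       (Fin.any? λ w → Adj? G u w ×-dec walk? G w v ℓ)

least : {P : ℕ → Set} → (∀ i → Dec (P i)) → ∀ m → P m →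
        ∃ λ d → P d × (∀ j → P j → d ≤ j)
least P? zero    p = 0 , p , λ _ _ → z≤n
least {P} P? (suc m) p with P? 0
... | yes p₀ = 0 , p₀ , λ _ _ → z≤n
... | no ¬p₀ with least (λ i → P? (suc i)) m p
...   | d , pd , min = suc d , pd , λ where
          zero    p₀ → ⊥-elim (¬p₀ p₀)
          (suc j) pj → s≤s (min j pj)

-- A walk of minimum length is automatically a path.
shortest : ∀ {n} (G : Graph n) → Connected G → ∀ u v →
           ∃ λ d → Walk G u v d × (∀ ℓ → Walk G u v ℓ → d ≤ ℓ)
shortest G conn u v =
  least (walk? G u v) (proj₁ (conn u v)) (proj₂ (conn u v))

dist : ∀ {n} (G : Graph n) → Connected G → Fin n → Fin n → ℕ
dist G conn u v = proj₁ (shortest G conn u v)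

-- Each unordered pair {u , v} is counted once, as the pair with u < v.
wiener : ∀ {n} (G : Graph n) → Connected G → ℕ
wiener {n} G conn =
  ∑[ u < n ] ∑[ v < n ] (if does (u Fin.<? v) then dist G conn u v else 0)

record 𝔗 (n k : ℕ) : Set₁ where
  field
    graph     : Graph n
    connected : Connected graph
    acyclic   : Acyclic graph
    pendant   : length (pendants graph) ≡ k

open 𝔗 using (graph; connected)

W : ∀ {n k} → 𝔗 n k → ℕ
W T = wiener (graph T) (connected T)

P : ∀ m → Graph m
P m = record
  { _~_   = λ i j → toℕ j ≡ suc (toℕ i) ⊎ toℕ i ≡ suc (toℕ j)
  ; _~?_  = λ i j → (toℕ j ≟ suc (toℕ i)) ⊎-dec (toℕ i ≟ suc (toℕ j))
  ; ~-sym = swap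
  ; ~-irr = λ { (inj₁ e) → ℕ.m≢1+n+m _ e ; (inj₂ e) → ℕ.m≢1+n+m _ e }
  }

infixr 6 _∪_
infixr 7 _·_
infixl 8 _∖_

_∪_ : ∀ {m n} → Graph m → Graph n → Graph (m + n)
_∪_ {m} G H = record
  { _~_   = λ i j → Pointwise (Adj G) (Adj H) (splitAt m i) (splitAt m j)
  ; _~?_  = λ i j → ⊎-decidable (Adj? G) (Adj? H) (splitAt m i) (splitAt m j)
  ; ~-sym = ⊎-symmetric (Graph.~-sym G) (Graph.~-sym H)
  ; ~-irr = λ {v} → irr (splitAt m v)
  }
  where
  irr : ∀ x → ¬ Pointwise (Adj G) (Adj H) x x
  irr _ (inj₁ a) = Graph.~-irr G a
  irr _ (inj₂ a) = Graph.~-irr H a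

-- The disjoint union of r copies of G; a vertex is a pair (copy , vertex).
_·_ : ∀ {m} (r : ℕ) → Graph m → Graph (r * m)
_·_ {m} r G = record
  { _~_   = λ i j → copy i ≡ copy j × Adj G (pos i) (pos j)
  ; _~?_  = λ i j → (copy i Fin.≟ copy j) ×-dec Adj? G (pos i) (pos j)
  ; ~-sym = λ { (e , a) → sym e , Graph.~-sym G a }
  ; ~-irr = λ { (_ , a) → Graph.~-irr G a }
  }
  where
  copy : Fin (r * m) → Fin r
  copy i = proj₁ (remQuot m i)
  pos : Fin (r * m) → Fin m
  pos i = proj₂ (remQuot {r} m i)

_∖_ : ∀ {n} → Graph n → Fin n → Graph (n ∸ 1)
_∖_ {suc n} G v = record
  { _~_   = λ i j → Adj G (punchIn v i) (punchIn v j)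
  ; _~?_  = λ i j → Adj? G (punchIn v i) (punchIn v j)
  ; ~-sym = Graph.~-sym G
  ; ~-irr = Graph.~-irr G
  }

-- The property that determines T_{n,k} up to isomorphism within 𝔗 n k.
IsT : ∀ n k .{{_ : NonZero k}} → 𝔗 n k → Set
IsT n k T = ∃ λ v → degree G v ≡ k ×
                    (G ∖ v ≅ r · P (suc q) ∪ (k ∸ r) · P q)
  where
  G = graph T
  q = (n ∸ 1) / k
  r = n ∸ 1 ∸ k * q

module Existence where

  count : ∀ {n m} {P : Fin n → Set} (P? : ∀ v → Dec (P v)) (f : Fin m → Fin n) →
          (∀ {i j} → f i ≡ f j → i ≡ j) → (∀ i → P (f i)) →
          (∀ v → P v → ∃ λ i → v ≡ f i) →
          length (filter P? (allFin n)) ≡ m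
  count {n} {m} P? f inj sound complete =
    trans (↭-length (∼bag⇒↭ (unique∧set⇒bag
            (Uniq.filter⁺ P? (Uniq.allFin⁺ n)) (Uniq.tabulate⁺ inj)
            (mk⇔ to from))))
          (List.length-tabulate f)
    where
    to : ∀ {v} → v ∈ filter P? (allFin n) → v ∈ tabulate f
    to {v} v∈ with complete v (proj₂ (∈-filter⁻ P? {xs = allFin n} v∈))
    ... | i , refl = ∈-tabulate⁺ i
    from : ∀ {v} → v ∈ tabulate f → v ∈ filter P? (allFin n)
    from v∈ with ∈-tabulate⁻ v∈
    ... | i , refl = ∈-filter⁺ P? (∈-allFin _) (sound i)

  divMod-unique : ∀ k .{{_ : NonZero k}} {a b} x y → a < k → b < k →
                  a + x * k ≡ b + y * k → a ≡ b × x ≡ y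
  divMod-unique k {a} {b} x y a<k b<k e = a≡b , ℕ.*-cancelʳ-≡ x y k
      (ℕ.+-cancelˡ-≡ a _ _ (trans e (cong (_+ y * k) (sym a≡b))))
    where
    a≡b = begin
      a               ≡⟨ m<n⇒m%n≡m a<k ⟨
      a % k           ≡⟨ [m+kn]%n≡m%n a x k ⟨
      (a + x * k) % k ≡⟨ cong (_% k) e ⟩
      (b + y * k) % k ≡⟨ [m+kn]%n≡m%n b y k ⟩
      b % k           ≡⟨ m<n⇒m%n≡m b<k ⟩
      b               ∎
      where open ≡-Reasoning

  -- Label the centre 0 and let the neighbour of i > 0 towards the centre be
  -- i ∸ k; the legs are then the residue classes modulo k of 1, …, m.
  module Spider (m k' : ℕ) (2≤k : 2 ≤ suc k') (k<m : suc k' < m) where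
    k = suc k'
    n = suc m

    Par : ℕ → ℕ → Set
    Par a b = a < b × a ≡ b ∸ k

    Par? : ∀ a b → Dec (Par a b)
    Par? a b = (a <? b) ×-dec (a ≟ b ∸ k)

    G : Graph n
    G = record
      { _~_   = λ i j → Par (toℕ i) (toℕ j) ⊎ Par (toℕ j) (toℕ i)
      ; _~?_  = λ i j → Par? (toℕ i) (toℕ j) ⊎-dec Par? (toℕ j) (toℕ i)
      ; ~-sym = swap
      ; ~-irr = λ { (inj₁ (l , _)) → ℕ.<-irrefl refl l ; (inj₂ (l , _)) → ℕ.<-irrefl refl l }
      }

    Parᶠ : Fin n → Fin n → Set
    Parᶠ u v = Par (toℕ u) (toℕ v)

    par-unique : ∀ {u v w : Fin n} → Parᶠ u w → Parᶠ v w → u ≡ v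
    par-unique (_ , e) (_ , e') = Fin.toℕ-injective (trans e (sym e'))

    _++_ : ∀ {u v w a b} → Walk G u v a → Walk G v w b → Walk G u w (a + b)
    []      ++ q = q
    (x ∷ p) ++ q = x ∷ (p ++ q)

    reverse : ∀ {u v a} → Walk G u v a → ∃ λ b → Walk G v u b
    reverse []      = 0 , []
    reverse (x ∷ p) = _ , proj₂ (reverse p) ++ (swap x ∷ [])

    parent : ∀ i → suc i < n → Σ (Fin n) λ u → toℕ u ≡ suc i ∸ k
    parent i l = fromℕ< (ℕ.≤-<-trans (ℕ.m∸n≤m (suc i) k) l) , Fin.toℕ-fromℕ< _

    to-centre : ∀ a (v : Fin n) → toℕ v ≡ a → ∃ λ ℓ → Walk G v zero ℓ
    to-centre = <-rec _ go
      where
      go : ∀ a → (∀ {b} → b < a → ∀ v → toℕ v ≡ b → ∃ (Walk G v zero)) →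
           ∀ v → toℕ v ≡ a → ∃ (Walk G v zero)
      go _ rec zero    refl = 0 , []
      go _ rec (suc i) refl with parent (toℕ i) (Fin.toℕ<n (suc i))
      ... | u , e = _ , inj₂ (u<v , e) ∷ proj₂ (rec u<v u refl)
        where u<v = subst (_< suc (toℕ i)) (sym e) (s≤s (ℕ.m∸n≤m (toℕ i) k'))

    G-connected : Connected G
    G-connected u v = _ , proj₂ (to-centre _ u refl) ++ proj₂ (reverse (proj₂ (to-centre _ v refl)))

    first∈ : ∀ {u v ℓ} (p : Walk G u v ℓ) → u ∈ vertices p
    first∈ []      = here refl
    first∈ (_ ∷ _) = here refl

    last∈ : ∀ {u v ℓ} (p : Walk G u v ℓ) → v ∈ vertices p
    last∈ []      = here refl
    last∈ (_ ∷ p) = there (last∈ p)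

    ascend : ∀ {x w v ℓ} (p : Walk G w v ℓ) → Unique (vertices p) → Parᶠ x w →
             ¬ (x ∈ vertices p) →
             toℕ w ≤ toℕ v × (w ≡ v ⊎ ∃ λ y → Parᶠ y v × y ∈ vertices p)
    ascend []            _        _  _  = ℕ.≤-refl , inj₁ refl
    ascend (inj₂ d ∷ p)  _        xw x∉ =
      ⊥-elim (x∉ (subst (_∈ _) (par-unique d xw) (there (first∈ p))))
    ascend (inj₁ a ∷ p)  (w∉ ∷ u) xw x∉ with ascend p u a (λ w∈ → All.lookup w∉ w∈ refl)
    ... | le , inj₁ refl         = ℕ.<⇒≤ (proj₁ a) , inj₂ (_ , a , here refl)
    ... | le , inj₂ (y , yv , y∈) = ℕ.≤-trans (ℕ.<⇒≤ (proj₁ a)) le , inj₂ (y , yv , there y∈)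

    descend : ∀ {u v ℓ} (p : Walk G u v ℓ) → Unique (vertices p) →
              toℕ v ≤ toℕ u ⊎ ∃ λ y → Parᶠ y v × y ∈ vertices p
    descend []           _        = inj₁ ℕ.≤-refl
    descend (inj₁ a ∷ p) (w∉ ∷ u) with ascend p u a (λ w∈ → All.lookup w∉ w∈ refl)
    ... | _ , inj₁ refl           = inj₂ (_ , a , here refl)
    ... | _ , inj₂ (y , yv , y∈)  = inj₂ (y , yv , there y∈)
    descend (inj₂ d ∷ p) (_ ∷ u) with descend p u
    ... | inj₁ le                 = inj₁ (ℕ.≤-trans le (ℕ.<⇒≤ (proj₁ d)))
    ... | inj₂ (y , yv , y∈)      = inj₂ (y , yv , there y∈)

    G-acyclic : Acyclic G
    G-acyclic (_ ∷ []) _ (s≤s ())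
    G-acyclic {u} {v} (_∷_ {w = w} a p@(_ ∷ p′)) (u∉ ∷ un@(w∉ ∷ _)) _ = close a
      where
      w≢v : ¬ (w ≡ v)
      w≢v refl = All.lookup w∉ (last∈ p′) refl
      parent∉ : Parᶠ u v → ¬ (∃ λ y → Parᶠ y v × y ∈ vertices p)
      parent∉ uv (y , yv , y∈) = All.lookup u∉ y∈ (par-unique {w = v} uv yv)
      close : Adj G u w → ¬ Adj G v u
      close (inj₁ a) e with ascend p un a (λ u∈ → All.lookup u∉ u∈ refl) | e
      ... | _  , inj₁ w≡v | _       = w≢v w≡v
      ... | _  , inj₂ y   | inj₂ uv = parent∉ uv y
      ... | le , inj₂ _   | inj₁ vu = ℕ.<⇒≱ (proj₁ a) (ℕ.≤-trans le (ℕ.<⇒≤ (proj₁ vu)))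
      close (inj₂ d) (inj₁ vu) = w≢v (par-unique {w = u} d vu)
      close (inj₂ d) (inj₂ uv) with descend p un
      ... | inj₁ le = ℕ.<⇒≱ (ℕ.<-trans (proj₁ d) (proj₁ uv)) le
      ... | inj₂ y  = parent∉ uv y

    child : ∀ {a b} → 0 < a → Par a b → b ≡ a + k
    child {a} {b} 0<a (_ , e) =
      trans (sym (ℕ.m∸n+n≡m {b} {k} (ℕ.<⇒≤ (ℕ.m∸n≢0⇒n<m {b} {k} λ z → ℕ.<⇒≢ 0<a (sym (trans e z)))))) (cong (_+ k) (sym e))

    par-child : ∀ a → Par a (a + k)
    par-child a = ℕ.m<m+n a (s≤s z≤n) , sym (ℕ.m+n∸n≡m a k)

    par-suc : ∀ a → Par (suc a ∸ k) (suc a)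
    par-suc a = s≤s (ℕ.m∸n≤m a k') , refl

    degree-centre : degree G zero ≡ k
    degree-centre = count (Adj? G zero) f
      (λ e → Fin.toℕ-injective (ℕ.suc-injective (trans (sym (f-toℕ _)) (trans (cong toℕ e) (f-toℕ _)))))
      (λ j → inj₁ (subst (Par 0) (sym (f-toℕ j)) (s≤s z≤n , sym (ℕ.m≤n⇒m∸n≡0 (Fin.toℕ≤pred[n] j)))))
      complete
      where
      bound : ∀ (j : Fin k) → suc (toℕ j) < n
      bound j = s≤s (ℕ.<-trans (Fin.toℕ<n j) k<m)
      f : Fin k → Fin n
      f j = fromℕ< (bound j)
      f-toℕ : ∀ j → toℕ (f j) ≡ suc (toℕ j)
      f-toℕ j = Fin.toℕ-fromℕ< (bound j)
      complete : ∀ v → Adj G zero v → ∃ λ j → v ≡ f j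
      complete (suc i) (inj₁ (_ , e)) = fromℕ< i<k ,
        Fin.toℕ-injective (sym (trans (f-toℕ _) (cong suc (Fin.toℕ-fromℕ< i<k))))
        where i<k = s≤s (ℕ.m∸n≡0⇒m≤n (sym e))

    module NonCentre (i : Fin m) where
      v = suc i
      up = parent (toℕ i) (Fin.toℕ<n v)

      up-adj : Parᶠ (proj₁ up) v
      up-adj = subst (λ a → Par a (toℕ v)) (sym (proj₂ up)) (par-suc (toℕ i))

      degree-leaf : n ≤ toℕ v + k → degree G v ≡ 1
      degree-leaf le = count (Adj? G v) f (λ { {zero} {zero} _ → refl }) (λ _ → inj₂ up-adj) complete
        where
        f : Fin 1 → Fin n
        f _ = proj₁ up
        complete : ∀ w → Adj G v w → ∃ λ j → w ≡ f j
        complete w (inj₁ vw) = ⊥-elim (ℕ.<⇒≱ (Fin.toℕ<n w) (subst (n ≤_) (sym (child (s≤s z≤n) vw)) le))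
        complete w (inj₂ wv) = zero , par-unique {w = v} wv up-adj

      degree-inner : toℕ v + k < n → degree G v ≡ 2
      degree-inner lt = count (Adj? G v) f inj sound complete
        where
        down : Fin n
        down = fromℕ< lt
        down-toℕ : toℕ down ≡ toℕ v + k
        down-toℕ = Fin.toℕ-fromℕ< lt
        down-adj : Parᶠ v down
        down-adj = subst (Par (toℕ v)) (sym down-toℕ) (par-child (toℕ v))
        up≢down : ¬ (proj₁ up ≡ down)
        up≢down e = ℕ.<-irrefl (cong toℕ e) (ℕ.<-trans (proj₁ up-adj) (proj₁ down-adj))
        f : Fin 2 → Fin n
        f zero    = proj₁ up
        f (suc _) = down
        inj : ∀ {i j} → f i ≡ f j → i ≡ j
        inj {zero}     {zero}     _ = refl
        inj {zero}     {suc zero} e = ⊥-elim (up≢down e)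
        inj {suc zero} {zero}     e = ⊥-elim (up≢down (sym e))
        inj {suc zero} {suc zero} _ = refl
        sound : ∀ i → Adj G v (f i)
        sound zero    = inj₂ up-adj
        sound (suc _) = inj₁ down-adj
        complete : ∀ w → Adj G v w → ∃ λ j → w ≡ f j
        complete w (inj₁ vw) = suc zero , Fin.toℕ-injective (trans (child (s≤s z≤n) vw) (sym down-toℕ))
        complete w (inj₂ wv) = zero , par-unique {w = v} wv up-adj

    pendant-count : length (pendants G) ≡ k
    pendant-count = count (λ v → degree G v ≟ 1) f
      (λ e → Fin.toℕ-injective (ℕ.+-cancelˡ-≡ (n ∸ k) _ _
               (trans (sym (f-toℕ _)) (trans (cong toℕ e) (f-toℕ _)))))
      (λ j → sound (f j) (subst (n ∸ k ≤_) (sym (f-toℕ j)) (ℕ.m≤m+n _ _)))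
      complete
      where
      k≤n = ℕ.≤-trans (ℕ.<⇒≤ k<m) (ℕ.n≤1+n m)
      bound : ∀ (j : Fin k) → n ∸ k + toℕ j < n
      bound j = subst (n ∸ k + toℕ j <_) (ℕ.m∸n+n≡m k≤n) (ℕ.+-monoʳ-< (n ∸ k) (Fin.toℕ<n j))
      f : Fin k → Fin n
      f j = fromℕ< (bound j)
      f-toℕ : ∀ j → toℕ (f j) ≡ n ∸ k + toℕ j
      f-toℕ j = Fin.toℕ-fromℕ< (bound j)
      sound : ∀ v → n ∸ k ≤ toℕ v → degree G v ≡ 1
      sound zero    le = ⊥-elim (ℕ.<⇒≱ (ℕ.m<n⇒0<n∸m (ℕ.<-trans k<m (ℕ.n<1+n m))) le)
      sound (suc i) le = NonCentre.degree-leaf i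
        (subst (_≤ suc (toℕ i) + k) (ℕ.m∸n+n≡m k≤n) (ℕ.+-monoˡ-≤ k le))
      complete : ∀ v → degree G v ≡ 1 → ∃ λ j → v ≡ f j
      complete zero    e = ⊥-elim (ℕ.<-irrefl refl (subst (2 ≤_) (trans (sym degree-centre) e) 2≤k))
      complete (suc i) e with suc (toℕ i) + k <? n
      ... | yes lt with trans (sym (NonCentre.degree-inner i lt)) e
      ...   | ()
      complete (suc i) e | no ¬lt = fromℕ< j<k , Fin.toℕ-injective (sym (trans (f-toℕ _)
          (trans (cong (n ∸ k +_) (Fin.toℕ-fromℕ< j<k)) (ℕ.m+[n∸m]≡n n∸k≤v))))
        where
        n≤ : n ≤ suc (toℕ i) + k
        n≤ = ℕ.≮⇒≥ ¬lt
        n∸k≤v : n ∸ k ≤ suc (toℕ i)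
        n∸k≤v = ℕ.m≤n+o⇒m∸n≤o n k (subst (n ≤_) (ℕ.+-comm (suc (toℕ i)) k) n≤)
        j<k : suc (toℕ i) ∸ (n ∸ k) < k
        j<k = ℕ.+-cancelˡ-< (n ∸ k) _ _ (subst₂ _<_ (sym (ℕ.m+[n∸m]≡n n∸k≤v))
                (sym (ℕ.m∸n+n≡m k≤n)) (Fin.toℕ<n (suc i)))

    tree : 𝔗 n k
    tree = record { graph = G ; connected = G-connected ; acyclic = G-acyclic ; pendant = pendant-count }

    q = m / k
    r = m ∸ k * q

    r≡ : r ≡ m % k
    r≡ = sym (trans (m%n≡m∸m/n*n m k) (cong (m ∸_) (ℕ.*-comm q k)))
    r<k : r < k
    r<k = subst (_< k) (sym r≡) (m%n<n m k)
    m≡ : m ≡ r + q * k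
    m≡ = trans (m≡m%n+[m/n]*n m k) (cong (_+ q * k) (sym r≡))

    A = r * suc q
    B = (k ∸ r) * q
    H = r · P (suc q) ∪ (k ∸ r) · P q

    col pos : Fin A ⊎ Fin B → ℕ
    col (inj₁ x) = toℕ (proj₁ (remQuot {r} (suc q) x))
    col (inj₂ x) = r + toℕ (proj₁ (remQuot {k ∸ r} q x))
    pos (inj₁ x) = toℕ (proj₂ (remQuot {r} (suc q) x))
    pos (inj₂ x) = toℕ (proj₂ (remQuot {k ∸ r} q x))

    AdjH : Fin A ⊎ Fin B → Fin A ⊎ Fin B → Set
    AdjH = Pointwise (Adj (r · P (suc q))) (Adj ((k ∸ r) · P q))

    col<k : ∀ s → col s < k
    col<k (inj₁ x) = ℕ.<-trans (Fin.toℕ<n (proj₁ (remQuot {r} (suc q) x))) r<k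
    col<k (inj₂ x) = subst (col (inj₂ x) <_) (ℕ.m+[n∸m]≡n (ℕ.<⇒≤ r<k))
      (ℕ.+-monoʳ-< r (Fin.toℕ<n (proj₁ (remQuot {k ∸ r} q x))))

    val : Fin A ⊎ Fin B → ℕ
    val s = col s + pos s * k

    val<m : ∀ s → val s < m
    val<m (inj₁ x) = subst (val (inj₁ x) <_) (sym m≡)
      (ℕ.+-mono-<-≤ (Fin.toℕ<n (proj₁ (remQuot {r} (suc q) x)))
        (ℕ.*-monoˡ-≤ k (Fin.toℕ≤pred[n] (proj₂ (remQuot {r} (suc q) x)))))
    val<m s@(inj₂ x) = ℕ.<-≤-trans (ℕ.+-monoˡ-< (pos s * k) (col<k s))
      (ℕ.≤-trans (ℕ.*-monoˡ-≤ k (Fin.toℕ<n (proj₂ (remQuot {k ∸ r} q x)))) (m/n*n≤m m k))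

    split : ∀ (s t : Fin A ⊎ Fin B) d e → val s + d * k ≡ val t + e * k →
            col s ≡ col t × pos s + d ≡ pos t + e
    split s t d e eq = divMod-unique k (pos s + d) (pos t + e) (col<k s) (col<k t)
      (trans (lem s d) (trans eq (sym (lem t e))))
      where
      lem : ∀ s d → col s + (pos s + d) * k ≡ val s + d * k
      lem s d = trans (cong (col s +_) (ℕ.*-distribʳ-+ k (pos s) d)) (sym (ℕ.+-assoc (col s) _ _))

    col-mixed : ∀ x y → ¬ (col (inj₁ x) ≡ col (inj₂ y))
    col-mixed x y e = ℕ.<⇒≱ (Fin.toℕ<n (proj₁ (remQuot {r} (suc q) x)))
      (subst (r ≤_) (sym e) (ℕ.m≤m+n r _))

    remQuot-inj : ∀ a {b} (x y : Fin (a * b)) →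
      toℕ (proj₁ (remQuot {a} b x)) ≡ toℕ (proj₁ (remQuot {a} b y)) →
      toℕ (proj₂ (remQuot {a} b x)) ≡ toℕ (proj₂ (remQuot {a} b y)) → x ≡ y
    remQuot-inj a {b} x y e f = trans (sym (Fin.combine-remQuot {a} b x))
      (trans (cong₂ combine (Fin.toℕ-injective e) (Fin.toℕ-injective f)) (Fin.combine-remQuot {a} b y))

    val-inj : ∀ s t → val s ≡ val t → s ≡ t
    val-inj s t e with split s t 0 0 (cong (_+ 0) e)
    val-inj (inj₁ x) (inj₁ y) _ | c , p = cong inj₁ (remQuot-inj r x y c (ℕ.+-cancelʳ-≡ 0 _ _ p))
    val-inj (inj₁ x) (inj₂ y) _ | c , _ = ⊥-elim (col-mixed x y c)
    val-inj (inj₂ x) (inj₁ y) _ | c , _ = ⊥-elim (col-mixed y x (sym c))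
    val-inj (inj₂ x) (inj₂ y) _ | c , p =
      cong inj₂ (remQuot-inj (k ∸ r) x y (ℕ.+-cancelˡ-≡ r _ _ c) (ℕ.+-cancelʳ-≡ 0 _ _ p))

    AdjH⇔ : ∀ s t → AdjH s t ⇔ (col s ≡ col t × (pos t ≡ suc (pos s) ⊎ pos s ≡ suc (pos t)))
    AdjH⇔ (inj₁ x) (inj₁ y) = mk⇔ (λ { (inj₁ (c , p)) → cong toℕ c , p })
                                  (λ { (c , p) → inj₁ (Fin.toℕ-injective c , p) })
    AdjH⇔ (inj₁ x) (inj₂ y) = mk⇔ (λ ()) (λ { (c , _) → ⊥-elim (col-mixed x y c) })
    AdjH⇔ (inj₂ x) (inj₁ y) = mk⇔ (λ ()) (λ { (c , _) → ⊥-elim (col-mixed y x (sym c)) })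
    AdjH⇔ (inj₂ x) (inj₂ y) = mk⇔ (λ { (inj₂ (c , p)) → cong (λ z → r + toℕ z) c , p })
                                  (λ { (c , p) → inj₂ (Fin.toℕ-injective (ℕ.+-cancelˡ-≡ r _ _ c) , p) })

    step→ : ∀ s t → col s ≡ col t → pos t ≡ suc (pos s) → Par (suc (val s)) (suc (val t))
    step→ s t c p = subst (Par (suc (val s))) (cong suc eq) (par-child (suc (val s)))
      where
      eq : val s + k ≡ val t
      eq = begin
        col s + pos s * k + k   ≡⟨ ℕ.+-assoc (col s) _ _ ⟩
        col s + (pos s * k + k) ≡⟨ cong₂ _+_ c (ℕ.+-comm (pos s * k) k) ⟩
        col t + suc (pos s) * k ≡⟨ cong (λ z → col t + z * k) p ⟨
        val t                   ∎
        where open ≡-Reasoning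

    step← : ∀ s t → Par (suc (val s)) (suc (val t)) → col s ≡ col t × pos t ≡ suc (pos s)
    step← s t par with split s t 1 0 (trans (cong (val s +_) (ℕ.+-identityʳ k))
                         (trans (sym (ℕ.suc-injective (child (s≤s z≤n) par))) (sym (ℕ.+-identityʳ _))))
    ... | c , p = c , trans (sym (ℕ.+-identityʳ _)) (trans (sym p) (ℕ.+-comm (pos s) 1))

    encode : (i : Fin m) → ∃ λ s → val s ≡ toℕ i
    encode i with toℕ i % k <? r
    ... | yes c<r = inj₁ (combine (fromℕ< c<r) (fromℕ< x<)) ,
        trans (cong₂ (λ a x → a + x * k) (trans (cong (λ z → toℕ (proj₁ z)) rq) (Fin.toℕ-fromℕ< c<r))
                                         (trans (cong (λ z → toℕ (proj₂ z)) rq) (Fin.toℕ-fromℕ< x<)))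
              (sym (m≡m%n+[m/n]*n (toℕ i) k))
      where
      x< : toℕ i / k < suc q
      x< = s≤s (/-monoˡ-≤ k (ℕ.<⇒≤ (Fin.toℕ<n i)))
      rq = Fin.remQuot-combine (fromℕ< c<r) (fromℕ< x<)
    ... | no c≮r = inj₂ (combine (fromℕ< c<) (fromℕ< x<)) ,
        trans (cong₂ (λ a x → r + a + x * k) (trans (cong (λ z → toℕ (proj₁ z)) rq) (Fin.toℕ-fromℕ< c<))
                                         (trans (cong (λ z → toℕ (proj₂ z)) rq) (Fin.toℕ-fromℕ< x<)))
              (trans (cong (_+ toℕ i / k * k) (ℕ.m+[n∸m]≡n r≤c)) (sym (m≡m%n+[m/n]*n (toℕ i) k)))
      where
      r≤c : r ≤ toℕ i % k
      r≤c = ℕ.≮⇒≥ c≮r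
      c< : toℕ i % k ∸ r < k ∸ r
      c< = ℕ.∸-monoˡ-< (m%n<n (toℕ i) k) r≤c
      x< : toℕ i / k < q
      x< = ℕ.*-cancelʳ-< k _ _ (ℕ.+-cancelˡ-< r _ _ (ℕ.≤-<-trans (ℕ.+-monoˡ-≤ _ r≤c)
        (subst₂ _<_ (m≡m%n+[m/n]*n (toℕ i) k) m≡ (Fin.toℕ<n i))))
      rq = Fin.remQuot-combine (fromℕ< c<) (fromℕ< x<)

    to : Fin m → Fin (A + B)
    to i = join A B (proj₁ (encode i))
    from : Fin (A + B) → Fin m
    from x = fromℕ< (val<m (splitAt A x))

    val-to : ∀ i → val (splitAt A (to i)) ≡ toℕ i
    val-to i = trans (cong val (Fin.splitAt-join A B (proj₁ (encode i)))) (proj₂ (encode i))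

    bijection : Permutation m (A + B)
    bijection = permutation to from
      (λ x → trans (cong (join A B) (val-inj (proj₁ (encode (from x))) (splitAt A x) (trans (proj₂ (encode (from x))) (Fin.toℕ-fromℕ< (val<m (splitAt A x))))))
                   (Fin.join-splitAt A B x))
      (λ i → Fin.toℕ-injective (trans (Fin.toℕ-fromℕ< (val<m (splitAt A (to i)))) (val-to i)))

    adjacency : ∀ i j → Adj (G ∖ zero) i j ⇔ Adj H (to i) (to j)
    adjacency i j = mk⇔
      (λ a → Equivalence.from (AdjH⇔ s t) (fwd (subst₂ Adjℕ (sym (val-to i)) (sym (val-to j)) a)))
      (λ a → subst₂ Adjℕ (val-to i) (val-to j) (bwd (Equivalence.to (AdjH⇔ s t) a)))
      where
      s = splitAt A (to i)
      t = splitAt A (to j)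
      Adjℕ : ℕ → ℕ → Set
      Adjℕ a b = Par (suc a) (suc b) ⊎ Par (suc b) (suc a)
      fwd : Adjℕ (val s) (val t) → col s ≡ col t × (pos t ≡ suc (pos s) ⊎ pos s ≡ suc (pos t))
      fwd (inj₁ p) = proj₁ (step← s t p) , inj₁ (proj₂ (step← s t p))
      fwd (inj₂ p) = sym (proj₁ (step← t s p)) , inj₂ (proj₂ (step← t s p))
      bwd : col s ≡ col t × (pos t ≡ suc (pos s) ⊎ pos s ≡ suc (pos t)) → Adjℕ (val s) (val t)
      bwd (c , inj₁ p) = inj₁ (step→ s t c p)
      bwd (c , inj₂ p) = inj₂ (step→ t s (sym c) p)

    tree-isT : IsT n k tree
    tree-isT = zero , degree-centre , record { bijection = bijection ; adjacency = adjacency }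

-- The property IsT is satisfiable in the whole range 2 ≤ k ≤ n - 2.
T-exists : ∀ n k .{{_ : NonZero k}} → 2 ≤ k → k + 2 ≤ n → Σ (𝔗 n k) (IsT n k)
T-exists (suc m) (suc k') 2≤k k+2≤n = tree , tree-isT
  where open Existence.Spider m k' 2≤k (s≤s⁻¹ (subst (_≤ suc m) (ℕ.+-comm (suc k') 2) k+2≤n))
T-exists zero (suc _) _ ()

{-# OPTIONS --safe #-}
-- Root a tree at a vertex c and let s x be the number of descendants of x.  An
-- edge separates s x vertices from the other n ∸ s x, so W = Σ s x * (n ∸ s x).
-- If c minimises the sum of the distances to it, then 2 * s x ≤ n for x ≢ c, a
-- range in which a * (n ∸ a) is strictly increasing.  Every x ≢ c has a pendant
-- vertex below it, and s is injective on the vertices above a given one, so for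
-- each i at most k vertices x ≢ c satisfy s x ≡ i.  Put p = (n ∸ 2) / k.  The sum
-- is therefore least exactly when each of the sizes 1, …, p occurs k times and
-- the remaining vertices have size p + 1, which forces the legs of a spider whose
-- lengths are p or p + 1.  As n ∸ 1 > k * p, these are the legs of T_{n,k}; with
-- p instead of q = (n ∸ 1) / k the case r = 0 needs no separate treatment.
module Submission where

open import Defs
open import Data.Bool.Base using (true; false; if_then_else_)
open import Data.Empty using (⊥; ⊥-elim)
open import Data.Fin.Base
  using (Fin; zero; suc; toℕ; fromℕ<; punchIn; punchOut; splitAt; join)
open import Data.Fin.Permutation as Perm using (Permutation; _⟨$⟩ʳ_; _⟨$⟩ˡ_)
import Data.Fin.Properties as Fin
open import Data.List.Base using (length; filter; tabulate; allFin)
import Data.List.Membership.DecPropositional as DecMembership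
open import Data.List.Membership.Propositional using (_∈_; _∉_)
open import Data.List.Membership.Propositional.Properties using (∈-allFin)
import Data.List.Relation.Unary.All as All
open import Data.List.Relation.Unary.All.Properties using (¬Any⇒All¬)
open import Data.List.Relation.Unary.AllPairs using ([]; _∷_)
open import Data.List.Relation.Unary.Any using (here; there)
open import Data.List.Relation.Unary.Unique.Propositional using (Unique)
open import Data.Nat
open import Data.Nat.DivMod
import Data.Nat.Properties as ℕ
open import Data.Nat.Tactic.RingSolver using (solve-∀)
open import Data.List.Extrema ℕ.≤-totalOrder using (argmin; f[argmin]≤f[xs])
open import Data.Product using (Σ; ∃; _×_; _,_; proj₁; proj₂)
open import Data.Sum.Base using (_⊎_; inj₁; inj₂)
open import Data.Unit.Base using (⊤; tt)
open import Function.Base using (_∘_; id)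
open import Function.Bundles using (_⇔_; mk⇔; Equivalence)
open import Relation.Binary.Definitions using (tri<; tri≈; tri>)
open import Relation.Binary.PropositionalEquality
open import Relation.Nullary using (¬_; Dec; yes; no; does)
open import Relation.Nullary.Decidable using (_×-dec_; ¬?; map′; dec-true; dec-false)
open import Algebra.Properties.Semiring.Sum ℕ.+-*-semiring
open Graph using () renaming (_~_ to Adj; _~?_ to Adj?; ~-sym to Adj-sym; ~-irr to Adj-irr)
open 𝔗 using (graph)

-- Sums and cardinalities

-- The constraint that each size occurs at most `k` times is handled by a dual certificate instead
-- of a sorting of the sizes. Each vertex of size `i ≤ p` is granted the shortfall of its term below
-- the term `τ` of size `p + 1`, and the root, whose own term is 0, is granted all of `τ`. Every
-- term then reaches `τ`, while the total granted is bounded by a constant that depends only on `n`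
-- and `k`. Equality becomes a condition on sizes relative to a root, `Balanced`. For an arbitrary
-- tree it is derived at a centroid; for `T_{n,k}` it is verified at the vertex named in `IsT`, and
-- the two roots are never compared. It remains to recover a tree from its sizes: full levels forbid
-- branching away from the root, and counting vertices fixes the number of legs of length `p + 1`,
-- so that legs can be paired by length. The formula for W comes from attaching to each vertex the
-- 0/1 vector of its ancestors: distance in the tree is the Hamming distance of these vectors.

sum-mono : ∀ {n} {f g : Fin n → ℕ} → (∀ i → f i ≤ g i) → sum f ≤ sum g
sum-mono {zero}  le = z≤n
sum-mono {suc n} le = ℕ.+-mono-≤ (le zero) (sum-mono (le ∘ suc))

-- If the sums agree, no term has slack. Both the exactness of a tight `Matching` and the equality
-- case of the bound are read off in this way.
sum-tight : ∀ {n} {f g : Fin n → ℕ} → (∀ i → f i ≤ g i) → sum g ≤ sum f →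
            ∀ i → f i ≡ g i
sum-tight {suc n} {f} {g} le ge zero = ℕ.≤-antisym (le zero)
  (ℕ.+-cancelʳ-≤ (sum (g ∘ suc)) _ _
    (ℕ.≤-trans ge (ℕ.+-monoʳ-≤ (f zero) (sum-mono (le ∘ suc)))))
sum-tight {suc n} {f} {g} le ge (suc i) = sum-tight (le ∘ suc)
  (ℕ.+-cancelˡ-≤ (g zero) _ _
    (ℕ.≤-trans ge (ℕ.+-monoˡ-≤ (sum (f ∘ suc)) (le zero)))) i

sum-const : ∀ n c → sum {n} (λ _ → c) ≡ n * c
sum-const zero    c = refl
sum-const (suc n) c = cong (c +_) (sum-const n c)

sum-zero : ∀ {n} {f : Fin n → ℕ} → (∀ i → f i ≡ 0) → sum f ≡ 0
sum-zero {n} z = trans (sum-cong-≗ z) (sum-replicate-zero n)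

sum-single : ∀ {n} {f : Fin n → ℕ} i → (∀ j → j ≢ i → f j ≡ 0) → sum f ≡ f i
sum-single {suc n} {f} zero z =
  trans (cong (f zero +_) (sum-zero λ j → z (suc j) λ ())) (ℕ.+-identityʳ _)
sum-single {suc n} {f} (suc i) z = trans (cong (_+ sum (f ∘ suc)) (z zero λ ()))
  (sum-single i λ j j≢i → z (suc j) (j≢i ∘ Fin.suc-injective))

term≤sum : ∀ {n} (f : Fin n → ℕ) i → f i ≤ sum f
term≤sum f zero    = ℕ.m≤m+n _ _
term≤sum f (suc i) = ℕ.≤-trans (term≤sum (f ∘ suc) i) (ℕ.m≤n+m _ _)

⟦_⟧ : ∀ {P : Set} → Dec P → ℕ
⟦ d ⟧ = if does d then 1 else 0

⟦⟧-yes : ∀ {P : Set} (d : Dec P) → P → ⟦ d ⟧ ≡ 1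
⟦⟧-yes d x rewrite dec-true d x = refl

⟦⟧-no : ∀ {P : Set} (d : Dec P) → ¬ P → ⟦ d ⟧ ≡ 0
⟦⟧-no d x rewrite dec-false d x = refl

⟦⟧≤1 : ∀ {P : Set} (d : Dec P) → ⟦ d ⟧ ≤ 1
⟦⟧≤1 (yes _) = s≤s z≤n
⟦⟧≤1 (no _)  = z≤n

⟦⟧-mono : ∀ {P Q : Set} (d : Dec P) (e : Dec Q) → (P → Q) → ⟦ d ⟧ ≤ ⟦ e ⟧
⟦⟧-mono (yes x) e f rewrite dec-true e (f x) = s≤s z≤n
⟦⟧-mono (no _)  e f = z≤n

⟦⟧-cong : ∀ {P Q : Set} (d : Dec P) (e : Dec Q) → (P → Q) → (Q → P) → ⟦ d ⟧ ≡ ⟦ e ⟧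
⟦⟧-cong d e f g = ℕ.≤-antisym (⟦⟧-mono d e f) (⟦⟧-mono e d g)

-- A sum of brackets instead of the length of a list: double counting is then an exchange of sums,
-- and disjoint cases add pointwise. `length-filter` links it to `degree` and `pendants`.
# : ∀ {n} {P : Fin n → Set} → (∀ i → Dec (P i)) → ℕ
# P? = sum (λ i → ⟦ P? i ⟧)

#-mono : ∀ {n} {P Q : Fin n → Set} (P? : ∀ i → Dec (P i)) (Q? : ∀ i → Dec (Q i)) →
         (∀ i → P i → Q i) → # P? ≤ # Q?
#-mono P? Q? f = sum-mono λ i → ⟦⟧-mono (P? i) (Q? i) (f i)

#-cong : ∀ {n} {P Q : Fin n → Set} (P? : ∀ i → Dec (P i)) (Q? : ∀ i → Dec (Q i)) →
         (∀ i → P i → Q i) → (∀ i → Q i → P i) → # P? ≡ # Q?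
#-cong P? Q? f g = sum-cong-≗ λ i → ⟦⟧-cong (P? i) (Q? i) (f i) (g i)

∈⇒1≤# : ∀ {n} {P : Fin n → Set} (P? : ∀ i → Dec (P i)) {i} → P i → 1 ≤ # P?
∈⇒1≤# P? {i} x = subst (_≤ # P?) (⟦⟧-yes (P? i) x) (term≤sum _ i)

1≤#⇒∈ : ∀ {n} {P : Fin n → Set} (P? : ∀ i → Dec (P i)) → 1 ≤ # P? → ∃ P
1≤#⇒∈ P? le with Fin.any? P?
... | yes x = x
... | no ¬x = ⊥-elim (ℕ.<⇒≱ le (ℕ.≤-reflexive (sum-zero λ i → ⟦⟧-no (P? i) λ x → ¬x (i , x))))

unique⇒#≤1 : ∀ {n} {P : Fin n → Set} (P? : ∀ i → Dec (P i)) →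
             (∀ {i j} → P i → P j → i ≡ j) → # P? ≤ 1
unique⇒#≤1 P? u with Fin.any? P?
... | yes (i , x) = subst (_≤ 1)
        (sym (sum-single i λ j j≢i → ⟦⟧-no (P? j) λ y → j≢i (u y x))) (⟦⟧≤1 (P? i))
... | no ¬x = subst (_≤ 1) (sym (sum-zero λ i → ⟦⟧-no (P? i) λ x → ¬x (i , x))) z≤n

#-single : ∀ {n} (i : Fin n) → # (Fin._≟ i) ≡ 1
#-single i = trans (sum-single i λ j → ⟦⟧-no (j Fin.≟ i)) (⟦⟧-yes (i Fin.≟ i) refl)

#≤1⇒unique : ∀ {n} {P : Fin n → Set} (P? : ∀ i → Dec (P i)) → # P? ≤ 1 →
             ∀ {i j} → P i → P j → i ≡ j
#≤1⇒unique P? le {i} {j} x y with i Fin.≟ j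
... | yes i≡j = i≡j
... | no  i≢j = ⊥-elim (ℕ.<⇒≱ (s≤s (s≤s z≤n)) (ℕ.≤-trans two le))
  where
  pt : ∀ l → ⟦ l Fin.≟ i ⟧ + ⟦ l Fin.≟ j ⟧ ≤ ⟦ P? l ⟧
  pt l with l Fin.≟ i | l Fin.≟ j
  ... | yes refl | yes l≡j = ⊥-elim (i≢j l≡j)
  ... | yes refl | no _    = ℕ.≤-reflexive (sym (⟦⟧-yes (P? l) x))
  ... | no _     | yes refl = ℕ.≤-reflexive (sym (⟦⟧-yes (P? l) y))
  ... | no _     | no _    = z≤n
  two : 2 ≤ # P?
  two = subst (_≤ # P?) (trans (∑-distrib-+ (λ l → ⟦ l Fin.≟ i ⟧) (λ l → ⟦ l Fin.≟ j ⟧)) (cong₂ _+_ (#-single i) (#-single j)))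
          (sum-mono pt)

length-filter-tabulate : ∀ {m n} {P : Fin n → Set} (P? : ∀ i → Dec (P i)) (h : Fin m → Fin n) →
                         length (filter P? (tabulate h)) ≡ # (P? ∘ h)
length-filter-tabulate {zero}  P? h = refl
length-filter-tabulate {suc m} P? h with does (P? (h zero))
... | true  = cong suc (length-filter-tabulate P? (h ∘ suc))
... | false = length-filter-tabulate P? (h ∘ suc)

length-filter : ∀ {n} {P : Fin n → Set} (P? : ∀ i → Dec (P i)) →
                length (filter P? (allFin n)) ≡ # P?
length-filter P? = length-filter-tabulate P? id

-- Double counting of the pairs of P × Q related by R: every element of P has
-- a partner and every element of Q at most one, so # P ≤ # Q, and if equality
-- holds then every element of either set has exactly one partner.
module Matching {a b} {P : Fin a → Set} {Q : Fin b → Set} {R : Fin a → Fin b → Set}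
  (P? : ∀ i → Dec (P i)) (Q? : ∀ j → Dec (Q j)) (R? : ∀ i j → Dec (R i j))
  (total : ∀ {i} → P i → ∃ λ j → Q j × R i j)
  (injective : ∀ {i i′ j} → P i → P i′ → Q j → R i j → R i′ j → i ≡ i′)
  where

  private
    M? : ∀ i j → Dec (P i × Q j × R i j)
    M? i j = P? i ×-dec Q? j ×-dec R? i j

    row : ∀ i → ⟦ P? i ⟧ ≤ # (M? i)
    row i with P? i in eq
    ... | no _  = z≤n
    ... | yes x with total x
    ...   | j , y , r = ℕ.≤-trans (ℕ.≤-reflexive (sym hit)) (term≤sum _ j)
      where
      hit : ⟦ yes x ×-dec Q? j ×-dec R? i j ⟧ ≡ 1
      hit = ⟦⟧-yes (yes x ×-dec Q? j ×-dec R? i j) (x , y , r)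

    column : ∀ j → # (λ i → M? i j) ≤ ⟦ Q? j ⟧
    column j with Q? j
    ... | yes y = unique⇒#≤1 (λ i → P? i ×-dec yes y ×-dec R? i j)
                    λ { (x , _ , r) (x′ , _ , r′) → injective x x′ y r r′ }
    ... | no ¬y = ℕ.≤-reflexive (sum-zero λ i →
                    ⟦⟧-no (P? i ×-dec no ¬y ×-dec R? i j) λ { (_ , y , _) → ¬y y })

    rows : # P? ≤ sum (λ i → # (M? i))
    rows = sum-mono row

    columns : sum (λ i → # (M? i)) ≤ # Q?
    columns = ℕ.≤-trans (ℕ.≤-reflexive (∑-comm λ i j → ⟦ M? i j ⟧)) (sum-mono column)

  card-≤ : # P? ≤ # Q?
  card-≤ = ℕ.≤-trans rows columns

  module _ (tight : # Q? ≤ # P?) where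

    surjective : ∀ {j} → Q j → ∃ λ i → P i × R i j
    surjective {j} y with 1≤#⇒∈ (λ i → M? i j) (ℕ.≤-reflexive (sym
        (trans (sum-tight column (ℕ.≤-trans tight (ℕ.≤-trans rows
          (ℕ.≤-reflexive (∑-comm λ i j → ⟦ M? i j ⟧)))) j) (⟦⟧-yes (Q? j) y))))
    ... | i , x , _ , r = i , x , r

    functional : ∀ {i j j′} → P i → Q j → Q j′ → R i j → R i j′ → j ≡ j′
    functional {i} x y y′ r r′ = #≤1⇒unique (M? i)
      (ℕ.≤-reflexive (trans (sym (sum-tight row (ℕ.≤-trans columns tight) i)) (⟦⟧-yes (P? i) x)))
      (x , y , r) (x , y′ , r′)

-- Greedy induction: `zero` is paired with any `i` of its colour, and deleting both lowers the count
-- of the same colour on each side. It is applied with leg lengths as colours.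
colour-matching : ∀ {n} (f g : Fin n → ℕ) → (∀ a → # (λ i → f i ≟ a) ≡ # (λ i → g i ≟ a)) →
                  ∃ λ (π : Permutation n n) → ∀ i → g (π ⟨$⟩ʳ i) ≡ f i
colour-matching {zero}  f g eq = Perm.id , λ ()
colour-matching {suc n} f g eq
  with 1≤#⇒∈ (λ i → g i ≟ f zero) (subst (1 ≤_) (eq (f zero)) (∈⇒1≤# (λ i → f i ≟ f zero) {zero} refl))
... | i , gi≡f0 with colour-matching (f ∘ suc) (g ∘ punchIn i) rest
  where
  rest : ∀ a → # (λ j → f (suc j) ≟ a) ≡ # (λ j → g (punchIn i j) ≟ a)
  rest a = ℕ.+-cancelˡ-≡ ⟦ f zero ≟ a ⟧ _ _
    (trans (eq a) (trans (sum-remove {i = i} (λ j → ⟦ g j ≟ a ⟧))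
      (cong (λ z → ⟦ z ≟ a ⟧ + # (λ j → g (punchIn i j) ≟ a)) gi≡f0)))
... | π , h = Perm.insert zero i π , λ where
  zero    → gi≡f0
  (suc j) → trans (cong g (Perm.insert-punchIn zero i π j)) (h j)

-- Walks and distances

-- Transposing the sum over `u < v` gives the sum over `v < u`, and the diagonal vanishes. The full
-- double sum no longer refers to the order of `Fin n`, so it can be permuted and factored.
sum-pairs : ∀ {n} (F : Fin n → Fin n → ℕ) → (∀ u v → F u v ≡ F v u) → (∀ u → F u u ≡ 0) →
            2 * sum (λ u → sum λ v → if does (u Fin.<? v) then F u v else 0) ≡
            sum (λ u → sum (F u))
sum-pairs {n} F F-sym F-irr = begin
  2 * S                            ≡⟨ cong (S +_) (ℕ.+-identityʳ S) ⟩
  S + S                            ≡⟨ cong (S +_) S≡S′ ⟩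
  S + sum (λ u → sum (L′ u))       ≡⟨ ∑-distrib-+ (λ u → sum (L u)) (λ u → sum (L′ u)) ⟨
  sum (λ u → sum (L u) + sum (L′ u)) ≡⟨ sum-cong-≗ (λ u → trans (sym (∑-distrib-+ (L u) (L′ u)))
                                          (sum-cong-≗ (split u))) ⟩
  sum (λ u → sum (F u))            ∎
  where
  open ≡-Reasoning
  L L′ : Fin n → Fin n → ℕ
  L u v = if does (u Fin.<? v) then F u v else 0
  L′ u v = L v u
  S = sum (λ u → sum (L u))
  S≡S′ : S ≡ sum (λ u → sum (L′ u))
  S≡S′ = ∑-comm L
  split : ∀ u v → L u v + L′ u v ≡ F u v
  split u v with Fin.<-cmp u v
  ... | tri< u<v _ v≮u rewrite dec-true (u Fin.<? v) u<v | dec-false (v Fin.<? u) v≮u = ℕ.+-identityʳ _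
  ... | tri> u≮v _ v<u rewrite dec-false (u Fin.<? v) u≮v | dec-true (v Fin.<? u) v<u = F-sym v u
  ... | tri≈ u≮u refl _ rewrite dec-false (u Fin.<? u) u≮u = sym (F-irr u)

module _ {n} {G : Graph n} where

  infixr 5 _⧺_
  _⧺_ : ∀ {u v w a b} → Walk G u v a → Walk G v w b → Walk G u w (a + b)
  []      ⧺ q = q
  (x ∷ p) ⧺ q = x ∷ (p ⧺ q)

  snoc : ∀ {u v w a} → Walk G u v a → Adj G v w → Walk G u w (suc a)
  snoc []      y = y ∷ []
  snoc (x ∷ p) y = x ∷ snoc p y

  reverse : ∀ {u v a} → Walk G u v a → Walk G v u a
  reverse []      = []
  reverse (x ∷ p) = snoc (reverse p) (Adj-sym G x)

  ∈-⧺⁻ : ∀ {u v w a b x} (p : Walk G u v a) (q : Walk G v w b) →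
         x ∈ vertices (p ⧺ q) → x ∈ vertices p ⊎ x ∈ vertices q
  ∈-⧺⁻ []      q x∈ = inj₂ x∈
  ∈-⧺⁻ (_ ∷ p) q (here e) = inj₁ (here e)
  ∈-⧺⁻ (_ ∷ p) q (there x∈) with ∈-⧺⁻ p q x∈
  ... | inj₁ x∈p = inj₁ (there x∈p)
  ... | inj₂ x∈q = inj₂ x∈q

  ∈-snoc⁻ : ∀ {u v w a x} (p : Walk G u v a) (y : Adj G v w) →
            x ∈ vertices (snoc p y) → x ∈ vertices p ⊎ x ≡ w
  ∈-snoc⁻ []      y (here e) = inj₁ (here e)
  ∈-snoc⁻ []      y (there (here e)) = inj₂ e
  ∈-snoc⁻ (_ ∷ p) y (here e) = inj₁ (here e)
  ∈-snoc⁻ (_ ∷ p) y (there x∈) with ∈-snoc⁻ p y x∈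
  ... | inj₁ x∈p = inj₁ (there x∈p)
  ... | inj₂ e   = inj₂ e

  ∈-reverse⁻ : ∀ {u v a x} (p : Walk G u v a) → x ∈ vertices (reverse p) → x ∈ vertices p
  ∈-reverse⁻ []      x∈ = x∈
  ∈-reverse⁻ (y ∷ p) x∈ with ∈-snoc⁻ (reverse p) (Adj-sym G y) x∈
  ... | inj₁ x∈p = there (∈-reverse⁻ p x∈p)
  ... | inj₂ e   = here e

  suffix : ∀ {u v w a} (p : Walk G w v a) → u ∈ vertices p →
           ∃ λ b → Σ (Walk G u v b) λ q → (Unique (vertices p) → Unique (vertices q)) ×
                                          (∀ {x} → x ∈ vertices q → x ∈ vertices p)
  suffix p@[]      (here refl) = _ , p , id , id
  suffix p@(_ ∷ _) (here refl) = _ , p , id , id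
  suffix (_ ∷ p)   (there u∈) with suffix p u∈
  ... | _ , q , uniq , sub = _ , q , (λ { (_ ∷ un) → uniq un }) , there ∘ sub

  loop-erase : ∀ {u v a} (p : Walk G u v a) →
               ∃ λ b → Σ (Walk G u v b) λ q → Unique (vertices q) ×
                                              (∀ {x} → x ∈ vertices q → x ∈ vertices p)
  loop-erase [] = _ , [] , All.[] ∷ [] , id
  loop-erase {u} (y ∷ p) with loop-erase p
  ... | _ , q , un , sub with DecMembership._∈?_ Fin._≟_ u (vertices q)
  ...   | no u∉ = _ , y ∷ q , ¬Any⇒All¬ _ u∉ ∷ un , λ { (here e) → here e ; (there x∈) → there (sub x∈) }
  ...   | yes u∈ with suffix q u∈
  ...     | _ , r , uniq , sub′ = _ , r , uniq un , there ∘ sub ∘ sub′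

  -- Loop erasure turns the walk into a path that still avoids `u`; putting `u` in front closes a
  -- cycle. Every use of acyclicity passes through this form.
  no-detour : Acyclic G → ∀ {u v w a} → Adj G u v → Adj G u w → v ≢ w →
              (p : Walk G v w a) → u ∉ vertices p → ⊥
  no-detour acyclic uv uw v≢w p u∉ with loop-erase p
  ... | _ , []         , _  , _   = v≢w refl
  ... | _ , q@(_ ∷ _) , un , sub =
    acyclic (uv ∷ q) (¬Any⇒All¬ _ (u∉ ∘ sub) ∷ un) (s≤s (s≤s z≤n)) (Adj-sym G uw)

module Distance {n} (G : Graph n) (conn : Connected G) where

  d : Fin n → Fin n → ℕ
  d = dist G conn

  geodesic : ∀ u v → Walk G u v (d u v)
  geodesic u v = proj₁ (proj₂ (shortest G conn u v))

  d-min : ∀ {u v a} → Walk G u v a → d u v ≤ a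
  d-min {u} {v} = proj₂ (proj₂ (shortest G conn u v)) _

  d-refl : ∀ u → d u u ≡ 0
  d-refl u = ℕ.n≤0⇒n≡0 (d-min [])

  d-sym : ∀ u v → d u v ≡ d v u
  d-sym u v = ℕ.≤-antisym (d-min (reverse (geodesic v u))) (d-min (reverse (geodesic u v)))

  d-triangle : ∀ u v w → d u w ≤ d u v + d v w
  d-triangle u v w = d-min (geodesic u v ⧺ geodesic v w)

  d-adj : ∀ {u w} v → Adj G u w → d u v ≤ suc (d w v)
  d-adj v uw = d-min (uw ∷ geodesic _ v)

  next : ∀ {u v} → u ≢ v → ∃ λ w → Adj G u w × d u v ≡ suc (d w v)
  next {u} {v} u≢v = go (geodesic u v) refl
    where
    go : ∀ {a} → Walk G u v a → a ≡ d u v → ∃ λ w → Adj G u w × d u v ≡ suc (d w v)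
    go []       _ = ⊥-elim (u≢v refl)
    go (uw ∷ p) e = _ , uw , ℕ.≤-antisym (d-adj v uw) (ℕ.≤-trans (s≤s (d-min p)) (ℕ.≤-reflexive e))

  2W≡ΣΣd : 2 * wiener G conn ≡ sum (λ u → sum (d u))
  2W≡ΣΣd = sum-pairs d d-sym d-refl

  -- A vertex other than the start begins a proper suffix of the walk. For a geodesic this means
  -- that later vertices are strictly nearer to its end.
  on-walk : ∀ {x u v a} (p : Walk G u v a) → x ∈ vertices p → x ≡ u ⊎ d x v < a
  on-walk []      (here e) = inj₁ e
  on-walk (_ ∷ p) (here e) = inj₁ e
  on-walk {v = v} (_ ∷ p) (there x∈) with on-walk p x∈
  ... | inj₁ refl = inj₂ (s≤s (d-min p))
  ... | inj₂ lt   = inj₂ (ℕ.m<n⇒m<1+n lt)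

  -- The geodesics from `w` and `w′` to `c` both avoid `v`, since their vertices after the start are
  -- strictly nearer to `c` than the start is. Joined at `c` they would form a detour around `v`.
  -- The non-strict bounds also cover neighbours at the same depth.
  unique-lower-neighbour : Acyclic G → ∀ c {v w w′} → Adj G v w → Adj G v w′ →
                           d w c ≤ d v c → d w′ c ≤ d v c → w ≡ w′
  unique-lower-neighbour acyclic c {v} {w} {w′} vw vw′ le le′ with w Fin.≟ w′
  ... | yes w≡w′ = w≡w′
  ... | no  w≢w′ = ⊥-elim (no-detour acyclic vw vw′ w≢w′ (geodesic w c ⧺ reverse (geodesic w′ c)) v∉)
    where
    avoids : ∀ {x} → Adj G v x → d x c ≤ d v c → v ∉ vertices (geodesic x c)
    avoids {x} vx le v∈ with on-walk (geodesic x c) v∈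
    ... | inj₁ refl = Adj-irr G vx
    ... | inj₂ lt   = ℕ.<⇒≱ lt le
    v∉ : v ∉ vertices (geodesic w c ⧺ reverse (geodesic w′ c))
    v∉ v∈ with ∈-⧺⁻ (geodesic w c) _ v∈
    ... | inj₁ v∈p = avoids vw le v∈p
    ... | inj₂ v∈q = avoids vw′ le′ (∈-reverse⁻ (geodesic w′ c) v∈q)

map-walk : ∀ {m n} {G : Graph m} {H : Graph n} (f : Fin m → Fin n) →
           (∀ {u v} → Adj G u v → Adj H (f u) (f v)) →
           ∀ {u v a} → Walk G u v a → Walk H (f u) (f v) a
map-walk f hom []      = []
map-walk f hom (x ∷ p) = hom x ∷ map-walk f hom p

-- The bijection need not preserve the condition `u < v`, so the invariance is proved for the
-- doubled sum over all ordered pairs.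
wiener-≅ : ∀ {m n} {G : Graph m} {H : Graph n} (cG : Connected G) (cH : Connected H) →
           G ≅ H → wiener G cG ≡ wiener H cH
wiener-≅ {G = G} {H} cG cH iso = ℕ.*-cancelˡ-≡ _ _ 2
  (trans G.2W≡ΣΣd (trans (sum-cong-≗ λ u → trans (sum-cong-≗ (d-≅ u)) (sym (∑-permute (H.d (f u)) bijection)))
    (trans (sym (∑-permute (λ u → sum (H.d u)) bijection)) (sym H.2W≡ΣΣd))))
  where
  open _≅_ iso
  module G = Distance G cG
  module H = Distance H cH
  f = bijection ⟨$⟩ʳ_
  g = bijection ⟨$⟩ˡ_
  back : ∀ {u v} → Adj H u v → Adj G (g u) (g v)
  back {u} {v} a = Equivalence.from (adjacency _ _)
    (subst₂ (Adj H) (sym (Perm.inverseʳ bijection)) (sym (Perm.inverseʳ bijection)) a)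
  d-≅ : ∀ u v → G.d u v ≡ H.d (f u) (f v)
  d-≅ u v = ℕ.≤-antisym
    (G.d-min (subst₂ (λ x y → Walk G x y (H.d (f u) (f v))) (Perm.inverseˡ bijection) (Perm.inverseˡ bijection)
      (map-walk g back (H.geodesic (f u) (f v)))))
    (H.d-min (map-walk f (Equivalence.to (adjacency _ _)) (G.geodesic u v)))

-- Rooted trees

module Rooted {n} (c : Fin n) (par : Fin n → Fin n) (dep : Fin n → ℕ)
  (dep-par : ∀ {u} → u ≢ c → dep u ≡ suc (dep (par u))) where

  infix 4 _⊑_ _⊑?_

  -- `x` is an ancestor of `u` or `u` itself. Each climbing step carries `u ≢ c`, because `par c` is
  -- an arbitrary vertex.
  data _⊑_ (x : Fin n) : Fin n → Set where
    here : x ⊑ x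
    up   : ∀ {u} → u ≢ c → x ⊑ par u → x ⊑ u

  par-induction : (P : Fin n → Set) → P c → (∀ {u} → u ≢ c → P (par u) → P u) → ∀ u → P u
  par-induction P base step u = go (suc (dep u)) u ℕ.≤-refl
    where
    go : ∀ N u → dep u < N → P u
    go (suc N) u lt with u Fin.≟ c
    ... | yes refl = base
    ... | no  u≢c = step u≢c (go N (par u) (s≤s⁻¹ (subst (_< suc N) (dep-par u≢c) lt)))

  ⊑-trans : ∀ {x y z} → x ⊑ y → y ⊑ z → x ⊑ z
  ⊑-trans p here       = p
  ⊑-trans p (up z≢c q) = up z≢c (⊑-trans p q)

  ⊑⇒dep≤ : ∀ {x u} → x ⊑ u → dep x ≤ dep u
  ⊑⇒dep≤ here       = ℕ.≤-refl
  ⊑⇒dep≤ (up u≢c p) = ℕ.≤-trans (⊑⇒dep≤ p)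
    (ℕ.≤-trans (ℕ.n≤1+n _) (ℕ.≤-reflexive (sym (dep-par u≢c))))

  ⊑⇒≡⊎⊑par : ∀ {x u} → x ⊑ u → x ≡ u ⊎ (u ≢ c × x ⊑ par u)
  ⊑⇒≡⊎⊑par here       = inj₁ refl
  ⊑⇒≡⊎⊑par (up u≢c p) = inj₂ (u≢c , p)

  ⊑⇒dep< : ∀ {x u} → x ⊑ u → x ≢ u → dep x < dep u
  ⊑⇒dep< here       x≢u = ⊥-elim (x≢u refl)
  ⊑⇒dep< (up u≢c p) _   = ℕ.≤-trans (s≤s (⊑⇒dep≤ p)) (ℕ.≤-reflexive (sym (dep-par u≢c)))

  par⊑ : ∀ {u} → u ≢ c → par u ⊑ u
  par⊑ u≢c = up u≢c here

  ⋢par : ∀ {u} → u ≢ c → ¬ u ⊑ par u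
  ⋢par u≢c p = ℕ.<⇒≱ (ℕ.≤-reflexive (sym (dep-par u≢c))) (⊑⇒dep≤ p)

  ⊑c⇒≡ : ∀ {x} → x ⊑ c → x ≡ c
  ⊑c⇒≡ here       = refl
  ⊑c⇒≡ (up c≢c _) = ⊥-elim (c≢c refl)

  c⊑ : ∀ u → c ⊑ u
  c⊑ = par-induction (c ⊑_) here up

  ⊑-antisym : ∀ {x y} → x ⊑ y → y ⊑ x → x ≡ y
  ⊑-antisym {x} {y} p q with x Fin.≟ y
  ... | yes x≡y = x≡y
  ... | no  x≢y = ⊥-elim (ℕ.<⇒≱ (⊑⇒dep< p x≢y) (⊑⇒dep≤ q))

  abstract
    _⊑?_ : ∀ x u → Dec (x ⊑ u)
    x ⊑? u = par-induction (λ u → Dec (x ⊑ u))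
      (map′ (λ { refl → here }) ⊑c⇒≡ (x Fin.≟ c)) step u
      where
      step : ∀ {u} → u ≢ c → Dec (x ⊑ par u) → Dec (x ⊑ u)
      step     u≢c (yes p) = yes (up u≢c p)
      step {u} u≢c (no ¬p) = map′ (λ { refl → here }) back (x Fin.≟ u)
        where
        back : x ⊑ u → x ≡ u
        back here     = refl
        back (up _ p) = ⊥-elim (¬p p)

  comparable : ∀ {x y u} → x ⊑ u → y ⊑ u → x ⊑ y ⊎ y ⊑ x
  comparable here     q        = inj₂ q
  comparable p        here     = inj₁ p
  comparable (up _ p) (up _ q) = comparable p q

  -- The complement is counted directly instead of as `n ∸ s x`, so that `s x * s̄ x` is a double
  -- sum of brackets over the pairs that `x` separates.
  s s̄ : Fin n → ℕ
  s x = # (x ⊑?_)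
  s̄ x = # (λ u → ¬? (x ⊑? u))

  s+s̄ : ∀ x → s x + s̄ x ≡ n
  s+s̄ x = trans (sym (∑-distrib-+ (λ u → ⟦ x ⊑? u ⟧) (λ u → ⟦ ¬? (x ⊑? u) ⟧)))
    (trans (sum-cong-≗ pt) (trans (sum-const n 1) (ℕ.*-identityʳ n)))
    where
    pt : ∀ u → ⟦ x ⊑? u ⟧ + ⟦ ¬? (x ⊑? u) ⟧ ≡ 1
    pt u with x ⊑? u
    ... | yes _ = refl
    ... | no  _ = refl

  s̄≡ : ∀ x → s̄ x ≡ n ∸ s x
  s̄≡ x = sym (trans (cong (_∸ s x) (sym (s+s̄ x))) (ℕ.m+n∸m≡n (s x) (s̄ x)))

  sc≡n : s c ≡ n
  sc≡n = trans (sum-cong-≗ λ u → ⟦⟧-yes (c ⊑? u) (c⊑ u))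
    (trans (sum-const n 1) (ℕ.*-identityʳ n))

  s≥1 : ∀ x → 1 ≤ s x
  s≥1 x = ∈⇒1≤# (x ⊑?_) here

  s-mono : ∀ {x y} → x ⊑ y → s y ≤ s x
  s-mono {x} {y} p = #-mono (y ⊑?_) (x ⊑?_) λ _ → ⊑-trans p

  -- `x`, `z` and the descendants of `y` are disjoint parts of the descendants of `x`. The extra 1
  -- over `s-strict` is what excludes branching at a vertex of size `p + 1`.
  s-strict₂ : ∀ {x y z} → x ⊑ y → x ≢ y → x ⊑ z → x ≢ z → ¬ y ⊑ z → 2 + s y ≤ s x
  s-strict₂ {x} {y} {z} xy x≢y xz x≢z y⋢z = subst (_≤ s x) total (sum-mono pt)
    where
    total : sum (λ u → ⟦ u Fin.≟ x ⟧ + (⟦ u Fin.≟ z ⟧ + ⟦ y ⊑? u ⟧)) ≡ 2 + s y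
    total = trans (∑-distrib-+ (λ u → ⟦ u Fin.≟ x ⟧) (λ u → ⟦ u Fin.≟ z ⟧ + ⟦ y ⊑? u ⟧))
      (cong₂ _+_ (#-single x) (trans (∑-distrib-+ (λ u → ⟦ u Fin.≟ z ⟧) (λ u → ⟦ y ⊑? u ⟧))
        (cong (_+ s y) (#-single z))))
    pt : ∀ u → ⟦ u Fin.≟ x ⟧ + (⟦ u Fin.≟ z ⟧ + ⟦ y ⊑? u ⟧) ≤ ⟦ x ⊑? u ⟧
    pt u with u Fin.≟ x | u Fin.≟ z
    ... | yes refl | yes refl = ⊥-elim (x≢z refl)
    ... | yes refl | no _ rewrite ⟦⟧-no (y ⊑? x) (λ yx → x≢y (⊑-antisym xy yx)) =
      ℕ.≤-reflexive (sym (⟦⟧-yes (x ⊑? x) here))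
    ... | no _ | yes refl rewrite ⟦⟧-no (y ⊑? z) y⋢z = ℕ.≤-reflexive (sym (⟦⟧-yes (x ⊑? z) xz))
    ... | no _ | no _ = ⟦⟧-mono (y ⊑? u) (x ⊑? u) (⊑-trans xy)

  s-strict : ∀ {x y} → x ⊑ y → x ≢ y → s y < s x
  s-strict {x} {y} xy x≢y = subst (_≤ s x) total (sum-mono pt)
    where
    total : sum (λ u → ⟦ u Fin.≟ x ⟧ + ⟦ y ⊑? u ⟧) ≡ 1 + s y
    total = trans (∑-distrib-+ (λ u → ⟦ u Fin.≟ x ⟧) (λ u → ⟦ y ⊑? u ⟧))
      (cong (_+ s y) (#-single x))
    pt : ∀ u → ⟦ u Fin.≟ x ⟧ + ⟦ y ⊑? u ⟧ ≤ ⟦ x ⊑? u ⟧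
    pt u with u Fin.≟ x
    ... | yes refl rewrite ⟦⟧-no (y ⊑? x) (λ yx → x≢y (⊑-antisym xy yx)) =
      ℕ.≤-reflexive (sym (⟦⟧-yes (x ⊑? x) here))
    ... | no _ = ⟦⟧-mono (y ⊑? u) (x ⊑? u) (⊑-trans xy)

  -- The vertices above `u` form a chain, and `s` strictly decreases down a chain.
  s-injective-above : ∀ {x y u} → x ⊑ u → y ⊑ u → s x ≡ s y → x ≡ y
  s-injective-above {x} {y} xu yu e with x Fin.≟ y | comparable xu yu
  ... | yes x≡y | _       = x≡y
  ... | no  x≢y | inj₁ xy = ⊥-elim (ℕ.<⇒≢ (s-strict xy x≢y) (sym e))
  ... | no  x≢y | inj₂ yx = ⊥-elim (ℕ.<⇒≢ (s-strict yx (x≢y ∘ sym)) e)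

  Child : Fin n → Fin n → Set
  Child v w = w ≢ c × par w ≡ v

  Child? : ∀ v w → Dec (Child v w)
  Child? v w = ¬? (w Fin.≟ c) ×-dec (par w Fin.≟ v)

  child⊑ : ∀ {v w} → Child v w → v ⊑ w
  child⊑ (w≢c , refl) = par⊑ w≢c

  child≢ : ∀ {v w} → Child v w → v ≢ w
  child≢ {w = w} (w≢c , refl) e = ⋢par w≢c (subst (w ⊑_) (sym e) here)

  children-incomparable : ∀ {v w w′} → Child v w → Child v w′ → w ⊑ w′ → w ≡ w′
  children-incomparable cw@(w≢c , refl) (w′≢c , e) w⊑w′ with ⊑⇒≡⊎⊑par w⊑w′
  ... | inj₁ w≡w′ = w≡w′
  ... | inj₂ (_ , p) = ⊥-elim (⋢par w≢c (subst (_ ⊑_) e p))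

  child-between : ∀ {v u} → v ⊑ u → v ≢ u → ∃ λ w → Child v w × w ⊑ u
  child-between here v≢u = ⊥-elim (v≢u refl)
  child-between {v} {u} (up u≢c p) _ with v Fin.≟ par u
  ... | yes refl = u , (u≢c , refl) , here
  ... | no  v≢   with child-between p v≢
  ...   | w , cw , wp = w , cw , up u≢c wp

  bit : Fin n → Fin n → ℕ
  bit x u = ⟦ x ⊑? u ⟧

  bit-par : ∀ {u} → u ≢ c → ∀ x → bit x u ≡ ⟦ x Fin.≟ u ⟧ + bit x (par u)
  bit-par {u} u≢c x with x Fin.≟ u
  ... | yes refl rewrite ⟦⟧-no (x ⊑? par x) (⋢par u≢c) = ⟦⟧-yes (x ⊑? x) here
  ... | no  x≢u = ⟦⟧-cong (x ⊑? u) (x ⊑? par u)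
    (λ p → case (⊑⇒≡⊎⊑par p)) (up u≢c)
    where
    case : x ≡ u ⊎ (u ≢ c × x ⊑ par u) → x ⊑ par u
    case (inj₁ x≡u) = ⊥-elim (x≢u x≡u)
    case (inj₂ (_ , p)) = p

  -- χ u v counts the edges {x , par x} that separate u from v; the root
  -- contributes 0.
  χ : Fin n → Fin n → ℕ
  χ u v = sum λ x → ∣ bit x u - bit x v ∣

  χ-sym : ∀ u v → χ u v ≡ χ v u
  χ-sym u v = sum-cong-≗ λ x → ℕ.∣-∣-comm (bit x u) (bit x v)

  χ-triangle : ∀ u v w → χ u w ≤ χ u v + χ v w
  χ-triangle u v w = subst (χ u w ≤_)
    (∑-distrib-+ (λ x → ∣ bit x u - bit x v ∣) (λ x → ∣ bit x v - bit x w ∣))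
    (sum-mono λ x → ℕ.∣-∣-triangle (bit x u) (bit x v) (bit x w))

  χ-refl : ∀ u → χ u u ≡ 0
  χ-refl u = sum-zero λ x → ℕ.∣n-n∣≡0 (bit x u)

  -- Passing from `u` to its parent changes only the bit at `u`. As `u` is not above `v`, that bit
  -- of `v` is 0, so exactly one disagreement disappears.
  χ-step : ∀ {u v} → u ≢ c → ¬ u ⊑ v → χ u v ≡ suc (χ (par u) v)
  χ-step {u} {v} u≢c u⋢v = trans (sum-cong-≗ pt)
    (trans (∑-distrib-+ (λ x → ⟦ x Fin.≟ u ⟧) (λ x → ∣ bit x (par u) - bit x v ∣))
      (cong (_+ χ (par u) v) (#-single u)))
    where
    pt : ∀ x → ∣ bit x u - bit x v ∣ ≡ ⟦ x Fin.≟ u ⟧ + ∣ bit x (par u) - bit x v ∣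
    pt x rewrite bit-par u≢c x with x Fin.≟ u
    ... | no _ = refl
    ... | yes refl rewrite ⟦⟧-no (x ⊑? par x) (⋢par u≢c) | ⟦⟧-no (x ⊑? v) u⋢v = refl

  -- For bits, `∣ b u - b v ∣` is `b u * b̄ v + b̄ u * b v`, and each double sum of products
  -- factors.
  ΣΣ∣bit-bit∣ : ∀ x → sum (λ u → sum λ v → ∣ bit x u - bit x v ∣) ≡ 2 * (s x * s̄ x)
  ΣΣ∣bit-bit∣ x = begin
    sum (λ u → sum λ v → ∣ b u - b v ∣)
      ≡⟨ sum-cong-≗ (λ u → trans (sum-cong-≗ (λ v → pt u v))
           (∑-distrib-+ (λ v → b u * b̄ v) (λ v → b̄ u * b v))) ⟩
    sum (λ u → sum (λ v → b u * b̄ v) + sum (λ v → b̄ u * b v))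
      ≡⟨ ∑-distrib-+ (λ u → sum (λ v → b u * b̄ v)) (λ u → sum (λ v → b̄ u * b v)) ⟩
    sum (λ u → sum (λ v → b u * b̄ v)) + sum (λ u → sum (λ v → b̄ u * b v))
      ≡⟨ cong₂ _+_ (product b b̄) (product b̄ b) ⟩
    s x * s̄ x + s̄ x * s x
      ≡⟨ cong (s x * s̄ x +_) (trans (ℕ.*-comm (s̄ x) (s x)) (sym (ℕ.+-identityʳ _))) ⟩
    2 * (s x * s̄ x) ∎
    where
    open ≡-Reasoning
    b b̄ : Fin n → ℕ
    b = bit x
    b̄ u = ⟦ ¬? (x ⊑? u) ⟧
    pt : ∀ u v → ∣ b u - b v ∣ ≡ b u * b̄ v + b̄ u * b v
    pt u v with x ⊑? u | x ⊑? v
    ... | yes _ | yes _ = refl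
    ... | yes _ | no  _ = refl
    ... | no  _ | yes _ = refl
    ... | no  _ | no  _ = refl
    product : ∀ (f g : Fin n → ℕ) → sum (λ u → sum (λ v → f u * g v)) ≡ sum f * sum g
    product f g = trans (sum-cong-≗ λ u → sym (*-distribˡ-sum (f u) g))
      (sym (*-distribʳ-sum (sum g) f))

  ΣΣχ : sum (λ u → sum (χ u)) ≡ 2 * sum (λ x → s x * s̄ x)
  ΣΣχ = begin
    sum (λ u → sum λ v → sum λ x → D x u v)
      ≡⟨ sum-cong-≗ (λ u → ∑-comm (λ v x → D x u v)) ⟩
    sum (λ u → sum λ x → sum λ v → D x u v)
      ≡⟨ ∑-comm (λ u x → sum λ v → D x u v) ⟩
    sum (λ x → sum λ u → sum λ v → D x u v)
      ≡⟨ sum-cong-≗ ΣΣ∣bit-bit∣ ⟩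
    sum (λ x → 2 * (s x * s̄ x))
      ≡⟨ *-distribˡ-sum 2 (λ x → s x * s̄ x) ⟨
    2 * sum (λ x → s x * s̄ x) ∎
    where
    open ≡-Reasoning
    D : Fin n → Fin n → Fin n → ℕ
    D x u v = ∣ bit x u - bit x v ∣

-- Rooting a connected acyclic graph

module RootedTree {n} (G : Graph n) (conn : Connected G) (acyclic : Acyclic G) (c : Fin n) where

  open Distance G conn public

  abstract
    parent : ∀ u → ∃ λ w → u ≢ c → Adj G u w × d u c ≡ suc (d w c)
    parent u with u Fin.≟ c
    -- By default the root is its own parent; the property is promised only away from it.
    ... | yes u≡c = u , λ u≢c → ⊥-elim (u≢c u≡c)
    ... | no  u≢c with next u≢c
    ...   | w , uw , e = w , λ _ → uw , e

  par : Fin n → Fin n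
  par u = proj₁ (parent u)

  dep : Fin n → ℕ
  dep u = d u c

  adj-par : ∀ {u} → u ≢ c → Adj G u (par u)
  adj-par {u} u≢c = proj₁ (proj₂ (parent u) u≢c)

  dep-par : ∀ {u} → u ≢ c → dep u ≡ suc (dep (par u))
  dep-par {u} u≢c = proj₂ (proj₂ (parent u) u≢c)

  open Rooted c par dep dep-par public

  lower⇒par : ∀ {u w} → Adj G u w → dep w ≤ dep u → u ≢ c × w ≡ par u
  lower⇒par {u} {w} uw le = u≢c , unique-lower-neighbour acyclic c uw (adj-par u≢c) le
    (ℕ.≤-trans (ℕ.n≤1+n _) (ℕ.≤-reflexive (sym (dep-par u≢c))))
    where
    u≢c : u ≢ c
    u≢c refl = ℕ.<⇒≱ (⊑⇒dep< (c⊑ w) λ { refl → Adj-irr G uw }) le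

  adj⇒par : ∀ {u w} → Adj G u w → Child u w ⊎ Child w u
  adj⇒par {u} {w} uw with ℕ.≤-total (dep w) (dep u)
  ... | inj₁ le with lower⇒par uw le
  ...   | u≢c , e = inj₂ (u≢c , sym e)
  adj⇒par {u} {w} uw | inj₂ le with lower⇒par (Adj-sym G uw) le
  ...   | w≢c , e = inj₁ (w≢c , sym e)

  child⇒adj : ∀ {u w} → Child u w → Adj G u w
  child⇒adj (w≢c , refl) = Adj-sym G (adj-par w≢c)

  χ-adj : ∀ {u w} → Adj G u w → χ u w ≤ 1
  χ-adj {u} {w} uw with adj⇒par uw
  ... | inj₁ (w≢c , refl) = ℕ.≤-reflexive (trans (χ-sym (par w) w)
        (trans (χ-step w≢c (⋢par w≢c)) (cong suc (χ-refl (par w)))))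
  ... | inj₂ (u≢c , refl) = ℕ.≤-reflexive
        (trans (χ-step u≢c (⋢par u≢c)) (cong suc (χ-refl (par u))))

  χ-walk : ∀ {u v a} → Walk G u v a → χ u v ≤ a
  χ-walk {u} []      = ℕ.≤-reflexive (χ-refl u)
  χ-walk {u} {v} (_∷_ {w = w} uw p) = ℕ.≤-trans (χ-triangle u w v) (ℕ.+-mono-≤ (χ-adj uw) (χ-walk p))

  -- Induction on `dep u + dep v`, replacing the deeper vertex by its parent: it cannot lie above
  -- the other one, so `χ-step` applies. The converse inequality is `χ-walk` on a geodesic.
  d≤χ : ∀ u v → d u v ≤ χ u v
  d≤χ u v = go _ u v ℕ.≤-refl
    where
    go : ∀ N u v → dep u + dep v < N → d u v ≤ χ u v
    descend : ∀ N u v → dep u + dep v ≤ N → u ≢ v → dep v ≤ dep u → d u v ≤ χ u v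
    go (suc N) u v lt with u Fin.≟ v
    ... | yes refl = ℕ.≤-trans (ℕ.≤-reflexive (d-refl u)) z≤n
    ... | no  u≢v with ℕ.≤-total (dep v) (dep u)
    ...   | inj₁ le = descend N u v (s≤s⁻¹ lt) u≢v le
    ...   | inj₂ le = subst₂ _≤_ (d-sym v u) (χ-sym v u)
              (descend N v u (subst (_≤ N) (ℕ.+-comm (dep u) (dep v)) (s≤s⁻¹ lt)) (u≢v ∘ sym) le)
    descend N u v le′ u≢v le = ℕ.≤-trans (d-adj v (adj-par u≢c)) (ℕ.≤-trans (s≤s
      (go N (par u) v (subst (λ z → z + dep v ≤ N) (dep-par u≢c) le′)))
      (ℕ.≤-reflexive (sym (χ-step u≢c λ u⊑v → ℕ.<⇒≱ (⊑⇒dep< u⊑v u≢v) le))))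
      where
      u≢c : u ≢ c
      u≢c refl = ℕ.<⇒≱ (⊑⇒dep< (c⊑ v) u≢v) le

  W≡Σss̄ : wiener G conn ≡ sum (λ x → s x * s̄ x)
  W≡Σss̄ = ℕ.*-cancelˡ-≡ _ _ 2 (trans 2W≡ΣΣd (trans
    (sum-cong-≗ λ u → sum-cong-≗ λ v → ℕ.≤-antisym (d≤χ u v) (χ-walk (geodesic u v))) ΣΣχ))

  d-descendant : ∀ {x u} → Child c x → x ⊑ u → suc (d u x) ≤ dep u
  d-descendant {x} cx here rewrite d-refl x | dep-par (proj₁ cx) = s≤s z≤n
  d-descendant {x} cx (up {u} u≢c p) = ℕ.≤-trans (s≤s (d-adj x (adj-par u≢c)))
    (ℕ.≤-trans (s≤s (d-descendant cx p)) (ℕ.≤-reflexive (sym (dep-par u≢c))))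

  -- Moving the root to its child x brings the s x descendants of x one step
  -- closer and takes every other vertex at most one step further away.
  total-distance-child : ∀ {x} → Child c x → sum (λ u → d u x) + 2 * s x ≤ sum dep + n
  total-distance-child {x} cx@(x≢c , px≡c) = subst₂ _≤_
    (trans (∑-distrib-+ (λ u → d u x) (λ u → 2 * bit x u))
      (cong (sum (λ u → d u x) +_) (sym (*-distribˡ-sum 2 (bit x)))))
    (trans (∑-distrib-+ dep (λ _ → 1))
      (cong (sum dep +_) (trans (sum-const n 1) (ℕ.*-identityʳ n))))
    (sum-mono pt)
    where
    pt : ∀ u → d u x + 2 * bit x u ≤ dep u + 1
    pt u with x ⊑? u
    ... | yes p = subst (_≤ dep u + 1) (sym (ℕ.+-suc (d u x) 1)) (ℕ.+-monoˡ-≤ 1 (d-descendant cx p))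
    ... | no ¬p = subst (_≤ dep u + 1) (sym (ℕ.+-identityʳ _)) (ℕ.≤-trans (d-triangle u c x)
            (ℕ.+-monoʳ-≤ (dep u) (d-min (child⇒adj cx ∷ []))))

  top : ∀ {v} → v ≢ c → ∃ λ x → Child c x × x ⊑ v
  top v≢c = child-between (c⊑ _) (v≢c ∘ sym)

  Centroid : Set
  Centroid = ∀ {x} → x ≢ c → 2 * s x ≤ n

  -- It suffices to compare the root with its child `y` above `x`: cancelling the total distances
  -- leaves `2 * s y ≤ n`, and `s x ≤ s y`.
  minimal⇒centroid : (∀ x → sum dep ≤ sum (λ u → d u x)) → Centroid
  minimal⇒centroid minimal x≢c with top x≢c
  ... | y , cy , yx = ℕ.≤-trans (ℕ.*-monoʳ-≤ 2 (s-mono yx)) (ℕ.+-cancelˡ-≤ (sum dep) _ _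
    (ℕ.≤-trans (ℕ.+-monoˡ-≤ (2 * s y) (minimal y)) (total-distance-child cy)))

  Pendant : Fin n → Set
  Pendant v = degree G v ≡ 1

  Pendant? : ∀ v → Dec (Pendant v)
  Pendant? v = degree G v ≟ 1

  childless⇒pendant : ∀ {v} → v ≢ c → (∀ w → ¬ Child v w) → Pendant v
  childless⇒pendant {v} v≢c childless = trans (length-filter (Adj? G v))
    (trans (#-cong (Adj? G v) (Fin._≟ par v) to λ { _ refl → adj-par v≢c }) (#-single (par v)))
    where
    to : ∀ w → Adj G v w → w ≡ par v
    to w vw with adj⇒par vw
    ... | inj₁ cw      = ⊥-elim (childless w cw)
    ... | inj₂ (_ , e) = sym e

  pendant-below : ∀ {v} → v ≢ c → ∃ λ ℓ → Pendant ℓ × v ⊑ ℓ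
  pendant-below {v} v≢c = go _ v≢c ℕ.≤-refl
    where
    go : ∀ N {v} → v ≢ c → s v < N → ∃ λ ℓ → Pendant ℓ × v ⊑ ℓ
    go (suc N) {v} v≢c lt with Fin.any? (Child? v)
    ... | no childless = v , childless⇒pendant v≢c (λ w cw → childless (w , cw)) , here
    ... | yes (w , cw) with go N (proj₁ cw)
                              (ℕ.<-≤-trans (s-strict (child⊑ cw) (child≢ cw)) (s≤s⁻¹ lt))
    ...   | ℓ , pℓ , wℓ = ℓ , pℓ , ⊑-trans (child⊑ cw) wℓ

  Level : ℕ → Fin n → Set
  Level j x = x ≢ c × s x ≡ j

  Level? : ∀ j x → Dec (Level j x)
  Level? j x = ¬? (x Fin.≟ c) ×-dec (s x ≟ j)

  level-injective : ∀ {j x y u} → Level j x → Level j y → x ⊑ u → y ⊑ u → x ≡ y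
  level-injective (_ , e) (_ , e′) xu yu = s-injective-above xu yu (trans e (sym e′))

  -- Besides `level≤` this supplies the tight case: in a full level each vertex has exactly one
  -- pendant vertex below it, and each pendant vertex lies below one vertex of the level. The legs
  -- are rebuilt from this.
  module LevelMatching j = Matching {R = _⊑_} (Level? j) Pendant? _⊑?_
    (λ x∈ → pendant-below (proj₁ x∈)) (λ x∈ y∈ _ → level-injective x∈ y∈)

  -- No vertex other than `c` branches: the tree is a spider with body `c`, and the vertices other
  -- than `c` above a pendant vertex form its leg.
  UniquePendantBelow : Set
  UniquePendantBelow = ∀ {x ℓ ℓ′} → x ≢ c → Pendant ℓ → Pendant ℓ′ → x ⊑ ℓ → x ⊑ ℓ′ → ℓ ≡ ℓ′

  level≤ : ∀ j → # (Level? j) ≤ # Pendant?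
  level≤ j = LevelMatching.card-≤ j

minimiser : ∀ {n} (f : Fin (suc n) → ℕ) → ∃ λ i → ∀ j → f i ≤ f j
minimiser {n} f = argmin f zero (allFin (suc n)) ,
  λ j → All.lookup (f[argmin]≤f[xs] {f = f} zero (allFin (suc n))) (∈-allFin j)

centroid : ∀ {n} (G : Graph (suc n)) (conn : Connected G) (acyclic : Acyclic G) →
           ∃ λ c → RootedTree.Centroid G conn acyclic c
centroid G conn acyclic = minimal (minimiser λ x → sum λ u → dist G conn u x)
  where
  minimal : (∃ λ c → ∀ x → sum (λ u → dist G conn u c) ≤ sum (λ u → dist G conn u x)) →
            ∃ λ c → RootedTree.Centroid G conn acyclic c
  minimal (c , min) = c , RootedTree.minimal⇒centroid G conn acyclic c min

-- The lower bound

-- Write `n ∸ a` as `b + t` and `n ∸ b` as `a + t`, where `a + b < n` makes `t` positive. The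
-- products share `a * b` and differ by `(b - a) * t`.
product-strict : ∀ {n a b} → a < b → a + b < n → a * (n ∸ a) < b * (n ∸ b)
product-strict {n} {a} {b} a<b a+b<n with ℕ.m≤n⇒∃[o]m+o≡n a+b<n
... | e , refl = subst₂ _<_ (cong (a *_) (sym n∸a)) (cong (b *_) (sym n∸b)) lt
  where
  n∸a : suc (a + b + e) ∸ a ≡ b + suc e
  n∸a = trans (cong (_∸ a) (lem a b e)) (ℕ.m+n∸m≡n a (b + suc e))
    where
    lem : ∀ a b e → suc (a + b + e) ≡ a + (b + suc e)
    lem = solve-∀
  n∸b : suc (a + b + e) ∸ b ≡ a + suc e
  n∸b = trans (cong (_∸ b) (lem a b e)) (ℕ.m+n∸m≡n b (a + suc e))
    where
    lem : ∀ a b e → suc (a + b + e) ≡ b + (a + suc e)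
    lem = solve-∀
  lt : a * (b + suc e) < b * (a + suc e)
  lt = subst₂ _<_ (sym (ℕ.*-distribˡ-+ a b (suc e)))
    (trans (cong (_+ b * suc e) (ℕ.*-comm a b)) (sym (ℕ.*-distribˡ-+ b a (suc e))))
    (ℕ.+-monoʳ-< (a * b) (ℕ.*-monoˡ-< (suc e) a<b))

module Bound {n} (G : Graph n) (conn : Connected G) (acyclic : Acyclic G) (c : Fin n)
  (p : ℕ) (2+2p≤n : 2 * suc p ≤ n) where

  open RootedTree G conn acyclic c

  f : ℕ → ℕ
  f a = a * (n ∸ a)

  τ : ℕ
  τ = f (suc p)

  -- Adding gap i to f (s x) for each x of size i + 1 ≤ p raises all sizes below
  -- p + 1 to the common value τ, and at most # Pendant? vertices have that size.
  gap : Fin p → ℕ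
  gap i = τ ∸ f (suc (toℕ i))

  Gap : ℕ
  Gap = sum λ i → gap i * # Pendant?

  private
    f<τ : ∀ {a} → a ≤ p → f a < τ
    f<τ a≤p = product-strict (s≤s a≤p) (ℕ.<-≤-trans (ℕ.+-monoˡ-< (suc p) (s≤s a≤p))
      (ℕ.≤-trans (ℕ.≤-reflexive (cong (suc p +_) (sym (ℕ.+-identityʳ (suc p))))) 2+2p≤n))

    bonus : Fin n → ℕ
    bonus x = sum λ i → gap i * ⟦ Level? (suc (toℕ i)) x ⟧

    -- The root separates nothing, `s c * s̄ c ≡ 0`. Granting it `τ` makes the target of the sum a
    -- uniform `n * τ`.
    rootBonus : Fin n → ℕ
    rootBonus x = τ * ⟦ x Fin.≟ c ⟧

    value : Fin n → ℕ
    value x = s x * s̄ x + bonus x + rootBonus x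

    no-bonus : ∀ {x} → (∀ i → ¬ Level (suc (toℕ i)) x) → bonus x ≡ 0
    no-bonus {x} none = sum-zero λ i →
      trans (cong (gap i *_) (⟦⟧-no (Level? (suc (toℕ i)) x) (none i))) (ℕ.*-zeroʳ (gap i))

    s*s̄≡f : ∀ x → s x * s̄ x ≡ f (s x)
    s*s̄≡f x = cong (s x *_) (s̄≡ x)

    no-rootBonus : ∀ {x} → x ≢ c → rootBonus x ≡ 0
    no-rootBonus {x} x≢c = trans (cong (τ *_) (⟦⟧-no (x Fin.≟ c) x≢c)) (ℕ.*-zeroʳ τ)

    small-bonus : ∀ {x} → x ≢ c → ∀ j → j < p → s x ≡ suc j → bonus x ≡ τ ∸ f (s x)
    small-bonus {x} x≢c j j<p e = trans (sum-single i others)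
      (trans (cong (gap i *_) (⟦⟧-yes (Level? (suc (toℕ i)) x) (x≢c , s≡)))
        (trans (ℕ.*-identityʳ (gap i)) (cong (λ z → τ ∸ f z) (sym s≡))))
      where
      i = fromℕ< j<p
      s≡ : s x ≡ suc (toℕ i)
      s≡ = trans e (cong suc (sym (Fin.toℕ-fromℕ< j<p)))
      others : ∀ i′ → i′ ≢ i → gap i′ * ⟦ Level? (suc (toℕ i′)) x ⟧ ≡ 0
      others i′ i′≢i = trans (cong (gap i′ *_) (⟦⟧-no (Level? (suc (toℕ i′)) x)
        λ { (_ , e′) → i′≢i (Fin.toℕ-injective (ℕ.suc-injective (trans (sym e′) s≡))) }))
        (ℕ.*-zeroʳ (gap i′))

    large-bonus : ∀ {x} → p < s x → bonus x ≡ 0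
    large-bonus p<s = no-bonus λ { i (_ , e) → ℕ.<⇒≱ p<s (subst (_≤ p) (sym e) (Fin.toℕ<n i)) }

    value≡τ : ∀ x → (x ≢ c → s x ≤ suc p) → value x ≡ τ
    value≡τ x s≤ = cases (x Fin.≟ c)
      where
      root : value c ≡ τ
      root = begin
        s c * s̄ c + bonus c + rootBonus c
          ≡⟨ cong₂ (λ y z → y + z + rootBonus c) (trans (s*s̄≡f c) (cong f sc≡n))
               (no-bonus λ { i (c≢c , _) → c≢c refl }) ⟩
        n * (n ∸ n) + 0 + rootBonus c
          ≡⟨ cong₂ (λ y z → y + 0 + τ * z) (trans (cong (n *_) (ℕ.n∸n≡0 n)) (ℕ.*-zeroʳ n))
               (⟦⟧-yes (c Fin.≟ c) refl) ⟩
        τ * 1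
          ≡⟨ ℕ.*-identityʳ τ ⟩
        τ ∎
        where open ≡-Reasoning
      leveled : x ≢ c → ∀ a → s x ≡ a → f (s x) + bonus x ≡ τ
      leveled x≢c zero e = ⊥-elim (ℕ.<⇒≢ (s≥1 x) (sym e))
      leveled x≢c (suc j) e with j <? p
      ... | yes j<p = trans (cong (f (s x) +_) (small-bonus x≢c j j<p e))
              (ℕ.m+[n∸m]≡n (ℕ.<⇒≤ (f<τ (subst (_≤ p) (sym e) j<p))))
      ... | no  j≮p = trans (cong₂ _+_ (cong f s≡) (large-bonus (ℕ.≤-reflexive (sym s≡)))) (ℕ.+-identityʳ τ)
        where
        s≡ : s x ≡ suc p
        s≡ = ℕ.≤-antisym (s≤ x≢c) (subst (suc p ≤_) (sym e) (s≤s (ℕ.≮⇒≥ j≮p)))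
      cases : Dec (x ≡ c) → value x ≡ τ
      cases (yes refl) = root
      cases (no  x≢c)  = trans (cong₂ (λ y z → y + bonus x + z) (s*s̄≡f x) (no-rootBonus x≢c))
        (trans (ℕ.+-identityʳ _) (leveled x≢c (s x) refl))

    -- The centroid property enters here: `suc p < s x` and `2 * s x ≤ n` give `suc p + s x < n`, so
    -- `f` is still increasing between the two sizes.
    τ<value : ∀ {x} → 2 * s x ≤ n → suc p < s x → τ < value x
    τ<value {x} 2s≤n lt = ℕ.<-≤-trans (product-strict lt (ℕ.<-≤-trans (ℕ.+-monoˡ-< (s x) lt)
        (ℕ.≤-trans (ℕ.≤-reflexive (cong (s x +_) (sym (ℕ.+-identityʳ (s x))))) 2s≤n)))
      (ℕ.≤-trans (ℕ.≤-reflexive (sym (s*s̄≡f x)))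
        (ℕ.≤-trans (ℕ.m≤m+n _ (bonus x)) (ℕ.m≤m+n _ (rootBonus x))))

    τ≤value : Centroid → ∀ x → τ ≤ value x
    -- A value below `τ` cannot belong to the root or to a size up to `p + 1`, where `value≡τ`
    -- holds; for larger sizes the value exceeds `τ`.
    τ≤value cen x = ℕ.≮⇒≥ λ lt →
      let x≢c = λ x≡c → ℕ.<⇒≢ lt (value≡τ x λ x≢c → ⊥-elim (x≢c x≡c)) in
      ℕ.<-asym lt (τ<value (cen x≢c) (ℕ.≰⇒> λ s≤ → ℕ.<⇒≢ lt (value≡τ x λ _ → s≤)))

    Σvalue : sum value ≡ wiener G conn + sum (λ i → gap i * # (Level? (suc (toℕ i)))) + τ
    Σvalue = begin
      sum value
        ≡⟨ ∑-distrib-+ (λ x → s x * s̄ x + bonus x) rootBonus ⟩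
      sum (λ x → s x * s̄ x + bonus x) + sum rootBonus
        ≡⟨ cong₂ _+_ (∑-distrib-+ (λ x → s x * s̄ x) bonus) Σroot ⟩
      sum (λ x → s x * s̄ x) + sum bonus + τ
        ≡⟨ cong₂ (λ y z → y + z + τ) (sym W≡Σss̄) Σbonus ⟩
      wiener G conn + sum (λ i → gap i * # (Level? (suc (toℕ i)))) + τ ∎
      where
      open ≡-Reasoning
      Σroot : sum rootBonus ≡ τ
      Σroot = trans (sym (*-distribˡ-sum τ (λ x → ⟦ x Fin.≟ c ⟧)))
        (trans (cong (τ *_) (#-single c)) (ℕ.*-identityʳ τ))
      Σbonus : sum bonus ≡ sum (λ i → gap i * # (Level? (suc (toℕ i))))
      Σbonus = trans (∑-comm (λ x i → gap i * ⟦ Level? (suc (toℕ i)) x ⟧))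
        (sum-cong-≗ λ i → sym (*-distribˡ-sum (gap i) (λ x → ⟦ Level? (suc (toℕ i)) x ⟧)))

    gaps≤ : ∀ i → gap i * # (Level? (suc (toℕ i))) ≤ gap i * # Pendant?
    gaps≤ i = ℕ.*-monoʳ-≤ (gap i) (level≤ (suc (toℕ i)))

    Σvalue≤ : sum value ≤ wiener G conn + Gap + τ
    Σvalue≤ = ℕ.≤-trans (ℕ.≤-reflexive Σvalue)
      (ℕ.+-monoˡ-≤ τ (ℕ.+-monoʳ-≤ (wiener G conn) (sum-mono gaps≤)))

    nτ≡ : n * τ ≡ sum {n} (λ _ → τ)
    nτ≡ = sym (sum-const n τ)

  -- In view of `level≤` the second component says that each size from 1 to `p` occurs exactly
  -- `# Pendant?` times.
  Balanced : Set
  Balanced = (∀ {x} → x ≢ c → s x ≤ suc p) ×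
             (∀ {j} → j < p → # Pendant? ≤ # (Level? (suc j)))

  wiener-lower : Centroid → n * τ ≤ wiener G conn + Gap + τ
  wiener-lower cen = ℕ.≤-trans (ℕ.≤-reflexive nτ≡) (ℕ.≤-trans (sum-mono (τ≤value cen)) Σvalue≤)

  -- Balance alone fixes the Wiener index, so the extremal tree can be rooted at the vertex that
  -- `IsT` provides.
  balanced⇒wiener : Balanced → wiener G conn + Gap + τ ≡ n * τ
  balanced⇒wiener (s≤ , full) = begin
    wiener G conn + Gap + τ
      ≡⟨ cong (λ z → wiener G conn + z + τ) (sum-cong-≗ λ i → cong (gap i *_)
           (ℕ.≤-antisym (full (Fin.toℕ<n i)) (level≤ (suc (toℕ i))))) ⟩
    wiener G conn + sum (λ i → gap i * # (Level? (suc (toℕ i)))) + τ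
      ≡⟨ Σvalue ⟨
    sum value
      ≡⟨ sum-cong-≗ (λ x → value≡τ x s≤) ⟩
    sum {n} (λ _ → τ)
      ≡⟨ nτ≡ ⟨
    n * τ ∎
    where open ≡-Reasoning

  -- Two estimates become tight at once: `τ ≤ value x` at each vertex, which bounds the sizes, and
  -- `level≤` weighted by the gaps, which fills the levels.
  wiener⇒balanced : Centroid → wiener G conn + Gap + τ ≤ n * τ → Balanced
  wiener⇒balanced cen le = s≤ , full
    where
    τ≡value : ∀ x → τ ≡ value x
    τ≡value = sum-tight (τ≤value cen)
      (ℕ.≤-trans Σvalue≤ (ℕ.≤-trans le (ℕ.≤-reflexive nτ≡)))
    s≤ : ∀ {x} → x ≢ c → s x ≤ suc p
    s≤ {x} x≢c = ℕ.≮⇒≥ λ lt → ℕ.<⇒≢ (τ<value (cen x≢c) lt) (τ≡value x)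
    gaps≡ : ∀ i → gap i * # (Level? (suc (toℕ i))) ≡ gap i * # Pendant?
    gaps≡ = sum-tight gaps≤ (ℕ.+-cancelˡ-≤ (wiener G conn) _ _ (ℕ.+-cancelʳ-≤ τ _ _
      (ℕ.≤-trans le (ℕ.≤-trans (ℕ.≤-reflexive nτ≡) (ℕ.≤-trans (sum-mono (τ≤value cen))
        (ℕ.≤-reflexive Σvalue))))))
    full : ∀ {j} → j < p → # Pendant? ≤ # (Level? (suc j))
    -- The gap can be cancelled because `f` lies strictly below `τ` on sizes up to `p`.
    full {j} j<p = ℕ.≤-reflexive (sym (ℕ.*-cancelˡ-≡ _ _ (τ ∸ f (suc j)) {{>-nonZero (ℕ.m<n⇒0<n∸m (f<τ j<p))}}
      (subst (λ z → (τ ∸ f (suc z)) * # (Level? (suc z)) ≡ (τ ∸ f (suc z)) * # Pendant?)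
        (Fin.toℕ-fromℕ< j<p) (gaps≡ (fromℕ< j<p)))))

-- Spiders

module Unbranched {n} (G : Graph n) (conn : Connected G) (acyclic : Acyclic G) (c : Fin n)
  (unique-pendant : RootedTree.UniquePendantBelow G conn acyclic c)
  where

  open RootedTree G conn acyclic c

  only-child : ∀ {v w w′} → v ≢ c → Child v w → Child v w′ → w ≡ w′
  only-child v≢c cw@(w≢c , _) cw′@(w′≢c , _) with pendant-below w≢c | pendant-below w′≢c
  ... | ℓ , pℓ , wℓ | ℓ′ , pℓ′ , w′ℓ′
    with refl ← unique-pendant v≢c pℓ pℓ′ (⊑-trans (child⊑ cw) wℓ) (⊑-trans (child⊑ cw′) w′ℓ′)
    with comparable wℓ w′ℓ′
  ... | inj₁ ww′ = children-incomparable cw cw′ ww′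
  ... | inj₂ w′w = sym (children-incomparable cw′ cw w′w)

  -- With a single child, `v` has only itself in addition to the descendants of `w`. Hence `s` is
  -- the position on a leg, counted from the pendant end.
  s-child : ∀ {v w} → v ≢ c → Child v w → s v ≡ suc (s w)
  s-child {v} {w} v≢c cw = trans (sum-cong-≗ pt)
    (trans (∑-distrib-+ (λ u → ⟦ u Fin.≟ v ⟧) (bit w)) (cong (_+ s w) (#-single v)))
    where
    pt : ∀ u → bit v u ≡ ⟦ u Fin.≟ v ⟧ + bit w u
    pt u with u Fin.≟ v
    ... | yes refl = trans (⟦⟧-yes (v ⊑? v) here)
            (cong suc (sym (⟦⟧-no (w ⊑? v) λ wv → child≢ cw (⊑-antisym (child⊑ cw) wv))))
    ... | no u≢v = ⟦⟧-cong (v ⊑? u) (w ⊑? u) to (⊑-trans (child⊑ cw))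
      where
      to : v ⊑ u → w ⊑ u
      to vu with child-between vu (u≢v ∘ sym)
      ... | w′ , cw′ , w′u = subst (_⊑ u) (only-child v≢c cw′ cw) w′u

  -- `y` lies above `par x`, so `par x` is not the root and has size `suc (s x)` as well; on the
  -- chain above `ℓ` the size determines the vertex.
  par-above : ∀ {x y ℓ} → y ≢ c → x ⊑ ℓ → y ⊑ ℓ → s y ≡ suc (s x) → x ≢ c → par x ≡ y
  par-above {x} {y} y≢c xℓ yℓ e x≢c with comparable xℓ yℓ
  ... | inj₁ xy = ⊥-elim (ℕ.<⇒≱ (ℕ.≤-reflexive (sym e)) (s-mono xy))
  ... | inj₂ yx with ⊑⇒≡⊎⊑par yx
  ...   | inj₁ refl = ⊥-elim (ℕ.m≢1+n+m _ {0} e)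
  ...   | inj₂ (_ , y⊑px) = s-injective-above (par⊑ x≢c) yx
          (trans (s-child (λ px≡c → y≢c (⊑c⇒≡ (subst (y ⊑_) px≡c y⊑px))) (x≢c , refl)) (sym e))

  descendant-of-size : ∀ {v} j → v ≢ c → 1 ≤ j → j ≤ s v → ∃ λ w → v ⊑ w × w ≢ c × s w ≡ j
  descendant-of-size {v} j v≢c 1≤j j≤s = go (s v) refl v≢c j≤s
    where
    go : ∀ N {v} → s v ≡ N → v ≢ c → j ≤ s v → ∃ λ w → v ⊑ w × w ≢ c × s w ≡ j
    go N {v} e v≢c j≤s with s v ≟ j
    ... | yes s≡j = v , here , v≢c , s≡j
    ... | no  s≢j with Fin.any? (Child? v)
    ...   | no childless = ⊥-elim (s≢j (ℕ.≤-antisym (ℕ.≤-trans s≤1 1≤j) j≤s))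
      where
      alone : ∀ {u} → v ⊑ u → v ≡ u
      alone {u} vu with v Fin.≟ u
      ... | yes v≡u = v≡u
      ... | no  v≢u with child-between vu v≢u
      ...   | w , cw , _ = ⊥-elim (childless (w , cw))
      s≤1 : s v ≤ 1
      s≤1 = unique⇒#≤1 (v ⊑?_) λ vu vu′ → trans (sym (alone vu)) (alone vu′)
    go zero e v≢c j≤s | no s≢j | yes _ = ⊥-elim (ℕ.<⇒≱ 1≤j (subst (j ≤_) e j≤s))
    go (suc N) {v} e v≢c j≤s | no s≢j | yes (w , cw) with
      go N (ℕ.suc-injective (trans (sym (s-child v≢c cw)) e)) (proj₁ cw)
           (s≤s⁻¹ (subst (j <_) (s-child v≢c cw) (ℕ.≤∧≢⇒< j≤s (s≢j ∘ sym))))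
    ... | x , wx , x≢c , sx = x , ⊑-trans (child⊑ cw) wx , x≢c , sx

-- The last two fields are `Balanced`; that such a tree really is a spider is derived in `Legs`.
record SpiderTree (n p : ℕ) : Set₁ where
  field
    tree      : Graph n
    connected : Connected tree
    acyclic   : Acyclic tree
    centre    : Fin n
  open RootedTree tree connected acyclic centre public
  field
    1≤p     : 1 ≤ p
    bounded : ∀ {x} → x ≢ centre → s x ≤ suc p
    full    : ∀ {j} → j < p → # Pendant? ≤ # (Level? (suc j))

module Legs {n p} (S : SpiderTree n p) where

  open SpiderTree S public renaming (centre to c)

  At : Fin n → Fin n → ℕ → Set
  At x ℓ i = x ≢ c × Pendant ℓ × x ⊑ ℓ × s x ≡ i

  At? : ∀ x ℓ i → Dec (At x ℓ i)
  At? x ℓ i = ¬? (x Fin.≟ c) ×-dec Pendant? ℓ ×-dec (x ⊑? ℓ) ×-dec (s x ≟ i)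

  occupied : ∀ {ℓ j} → Pendant ℓ → j < p → ∃ λ x → At x ℓ (suc j)
  occupied {ℓ} {j} pℓ j<p with LevelMatching.surjective (suc j) (full j<p) pℓ
  ... | x , (x≢c , e) , xℓ = x , x≢c , pℓ , xℓ , e

  -- Sizes up to `p` belong to full levels. If `x` has size `p + 1`, take the vertices `y` and `y′`
  -- of size `p` above `ℓ` and `ℓ′`, which exist as `1 ≤ p`. Both lie below `x`; were they distinct,
  -- `s x` would be at least `p + 2`.
  unique-pendant : UniquePendantBelow
  unique-pendant {x} {ℓ} {ℓ′} x≢c pℓ pℓ′ xℓ xℓ′ = go _ refl
    where
    low : ∀ {x j} → j < p → x ≢ c → s x ≡ suc j → x ⊑ ℓ → x ⊑ ℓ′ → ℓ ≡ ℓ′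
    low {j = j} j<p x≢c e = LevelMatching.functional (suc j) (full j<p) (x≢c , e) pℓ pℓ′
    go : ∀ a → s x ≡ a → ℓ ≡ ℓ′
    go zero    e = ⊥-elim (ℕ.<⇒≢ (s≥1 x) (sym e))
    go (suc j) e with j <? p
    ... | yes j<p = low j<p x≢c e xℓ xℓ′
    ... | no  j≮p with occupied pℓ p-1<p | occupied pℓ′ p-1<p
      where
      p-1<p : pred p < p
      p-1<p = ℕ.≤-reflexive (ℕ.suc-pred p {{>-nonZero 1≤p}})
    ... | y , y≢c , _ , yℓ , sy | y′ , y′≢c , _ , y′ℓ′ , sy′ = main
      where
      sp : suc (pred p) ≡ p
      sp = ℕ.suc-pred p {{>-nonZero 1≤p}}
      sx : s x ≡ suc p
      sx = ℕ.≤-antisym (bounded x≢c) (subst (suc p ≤_) (sym e) (s≤s (ℕ.≮⇒≥ j≮p)))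
      x⊑ : ∀ {y l} → x ⊑ l → y ⊑ l → s y ≡ suc (pred p) → x ⊑ y × x ≢ y
      x⊑ {y} xl yl sy = below (comparable xl yl) , λ { refl → ℕ.<⇒≢ lt refl }
        where
        lt : s y < s x
        lt = ℕ.≤-reflexive (trans (cong suc (trans sy sp)) (sym sx))
        below : x ⊑ y ⊎ y ⊑ x → x ⊑ y
        below (inj₁ xy) = xy
        below (inj₂ yx) = ⊥-elim (ℕ.<⇒≱ lt (s-mono yx))
      main : ℓ ≡ ℓ′
      main with y ⊑? y′
      ... | yes yy′ with refl ← s-injective-above yy′ here (trans sy (sym sy′)) =
        low (ℕ.≤-reflexive sp) y≢c sy yℓ y′ℓ′
      ... | no y⋢y′ with x⊑ xℓ yℓ sy | x⊑ xℓ′ y′ℓ′ sy′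
      ...   | xy , x≢y | xy′ , x≢y′ = ⊥-elim (ℕ.<⇒≱ (ℕ.n<1+n _)
                (subst₂ _≤_ (cong (2 +_) (trans sy sp)) sx (s-strict₂ xy x≢y xy′ x≢y′ y⋢y′)))

  open Unbranched tree connected acyclic c unique-pendant public

  Long : Fin n → Set
  Long ℓ = ∃ λ x → At x ℓ (suc p)

  Long? : ∀ ℓ → Dec (Long ℓ)
  Long? ℓ = Fin.any? λ x → At? x ℓ (suc p)

  -- Defined on all vertices, with 0 off the pendant ones, so that it can serve as a colouring of
  -- `Fin n`.
  legLength : Fin n → ℕ
  legLength ℓ = p * ⟦ Pendant? ℓ ⟧ + ⟦ Long? ℓ ⟧

  long⇒pendant : ∀ {ℓ} → Long ℓ → Pendant ℓ
  long⇒pendant (_ , _ , pℓ , _) = pℓ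

  legLength-none : ∀ {ℓ} → ¬ Pendant ℓ → legLength ℓ ≡ 0
  legLength-none {ℓ} ¬pℓ = trans (cong₂ (λ i j → p * i + j) (⟦⟧-no (Pendant? ℓ) ¬pℓ)
    (⟦⟧-no (Long? ℓ) (¬pℓ ∘ long⇒pendant))) (trans (ℕ.+-identityʳ _) (ℕ.*-zeroʳ p))

  legLength-short : ∀ {ℓ} → Pendant ℓ → ¬ Long ℓ → legLength ℓ ≡ p
  legLength-short {ℓ} pℓ ¬long = trans (cong₂ (λ i j → p * i + j) (⟦⟧-yes (Pendant? ℓ) pℓ)
    (⟦⟧-no (Long? ℓ) ¬long)) (trans (ℕ.+-identityʳ _) (ℕ.*-identityʳ p))

  legLength-long : ∀ {ℓ} → Long ℓ → legLength ℓ ≡ suc p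
  legLength-long {ℓ} long = trans (cong₂ (λ i j → p * i + j) (⟦⟧-yes (Pendant? ℓ) (long⇒pendant long))
    (⟦⟧-yes (Long? ℓ) long)) (trans (ℕ.+-comm (p * 1) 1) (cong suc (ℕ.*-identityʳ p)))

  at⇒≤legLength : ∀ {x ℓ i} → At x ℓ i → i ≤ legLength ℓ
  at⇒≤legLength {x} {ℓ} (x≢c , pℓ , xℓ , refl) = cases (Long? ℓ)
    where
    cases : Dec (Long ℓ) → s x ≤ legLength ℓ
    cases (yes long) = ℕ.≤-trans (bounded x≢c) (ℕ.≤-reflexive (sym (legLength-long long)))
    cases (no ¬long) = ℕ.≤-trans (s≤s⁻¹ (ℕ.≤∧≢⇒< (bounded x≢c) λ e → ¬long (x , x≢c , pℓ , xℓ , e)))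
      (ℕ.≤-reflexive (sym (legLength-short pℓ ¬long)))

  ≤legLength⇒at : ∀ {ℓ i} → 1 ≤ i → i ≤ legLength ℓ → ∃ λ x → At x ℓ i
  ≤legLength⇒at {ℓ} {suc j} _ le = cases (Pendant? ℓ) (j <? p) (Long? ℓ)
    where
    cases : Dec (Pendant ℓ) → Dec (j < p) → Dec (Long ℓ) → ∃ λ x → At x ℓ (suc j)
    cases (no ¬pℓ) _ _ = ⊥-elim (ℕ.<⇒≱ (s≤s z≤n) (subst (suc j ≤_) (legLength-none ¬pℓ) le))
    cases (yes pℓ) (yes j<p) _ = occupied pℓ j<p
    cases (yes pℓ) (no j≮p) (no ¬long) =
      ⊥-elim (j≮p (subst (suc j ≤_) (legLength-short pℓ ¬long) le))
    cases (yes pℓ) (no j≮p) (yes long@(x , at)) = x , subst (At x ℓ) (cong suc (ℕ.≤-antisym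
      (ℕ.≮⇒≥ j≮p) (s≤s⁻¹ (subst (suc j ≤_) (legLength-long long) le)))) at

  #Long≡#Level : # Long? ≡ # (Level? (suc p))
  #Long≡#Level = ℕ.≤-antisym
    (Matching.card-≤ {R = λ ℓ x → x ⊑ ℓ} Long? (Level? (suc p)) (λ ℓ x → x ⊑? ℓ)
      (λ { (x , x≢c , _ , xℓ , e) → x , (x≢c , e) , xℓ })
      (λ { (_ , _ , pℓ , _) (_ , _ , pℓ′ , _) (x≢c , _) → unique-pendant x≢c pℓ pℓ′ }))
    (Matching.card-≤ {R = _⊑_} (Level? (suc p)) Long? _⊑?_ total
      (λ x∈ y∈ _ → level-injective x∈ y∈))
    where
    total : ∀ {x} → Level (suc p) x → ∃ λ ℓ → Long ℓ × x ⊑ ℓ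
    total {x} (x≢c , e) with pendant-below x≢c
    ... | ℓ , pℓ , xℓ = ℓ , (x , x≢c , pℓ , xℓ , e) , xℓ

  -- The root, `p` full levels and the level of size `p + 1` partition the vertices. This determines
  -- `# Long?` from `n`, `p` and the number of pendant vertices.
  vertex-count : n ≡ 1 + p * # Pendant? + # Long?
  vertex-count = begin
    n
      ≡⟨ trans (sum-const n 1) (ℕ.*-identityʳ n) ⟨
    sum {n} (λ _ → 1)
      ≡⟨ sum-cong-≗ pt ⟨
    sum (λ x → ⟦ x Fin.≟ c ⟧ + low x + ⟦ Level? (suc p) x ⟧)
      ≡⟨ ∑-distrib-+ (λ x → ⟦ x Fin.≟ c ⟧ + low x) (λ x → ⟦ Level? (suc p) x ⟧) ⟩
    sum (λ x → ⟦ x Fin.≟ c ⟧ + low x) + # (Level? (suc p))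
      ≡⟨ cong₂ _+_ (trans (∑-distrib-+ (λ x → ⟦ x Fin.≟ c ⟧) low) (cong₂ _+_ (#-single c) Σlow)) (sym #Long≡#Level) ⟩
    1 + p * # Pendant? + # Long? ∎
    where
    open ≡-Reasoning
    low : Fin n → ℕ
    low x = sum {p} λ i → ⟦ Level? (suc (toℕ i)) x ⟧
    Σlow : sum low ≡ p * # Pendant?
    Σlow = trans (∑-comm λ x (i : Fin p) → ⟦ Level? (suc (toℕ i)) x ⟧)
      (trans (sum-cong-≗ λ (i : Fin p) → ℕ.≤-antisym (level≤ (suc (toℕ i))) (full (Fin.toℕ<n i)))
        (sum-const p (# Pendant?)))
    pt : ∀ x → ⟦ x Fin.≟ c ⟧ + low x + ⟦ Level? (suc p) x ⟧ ≡ 1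
    pt x = cases (x Fin.≟ c)
      where
      low≡0 : (∀ (i : Fin p) → ¬ Level (suc (toℕ i)) x) → low x ≡ 0
      low≡0 none = sum-zero λ i → ⟦⟧-no (Level? (suc (toℕ i)) x) (none i)
      sizes : x ≢ c → ∀ a → s x ≡ a → low x + ⟦ Level? (suc p) x ⟧ ≡ 1
      sizes x≢c zero e = ⊥-elim (ℕ.<⇒≢ (s≥1 x) (sym e))
      sizes x≢c (suc j) e with j <? p
      ... | yes j<p = cong₂ _+_
              (trans (sum-single i λ i′ i′≢i → ⟦⟧-no (Level? (suc (toℕ i′)) x)
                  λ { (_ , e′) → i′≢i (Fin.toℕ-injective (ℕ.suc-injective (trans (sym e′) s≡))) })
                (⟦⟧-yes (Level? (suc (toℕ i)) x) (x≢c , s≡)))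
              (⟦⟧-no (Level? (suc p) x) λ { (_ , e′) → ℕ.<⇒≢ (s≤s j<p) (trans (sym e) e′) })
        where
        i = fromℕ< j<p
        s≡ : s x ≡ suc (toℕ i)
        s≡ = trans e (cong suc (sym (Fin.toℕ-fromℕ< j<p)))
      ... | no  j≮p = cong₂ _+_
              (low≡0 λ { i (_ , e′) → j≮p (subst (_< p) (ℕ.suc-injective (trans (sym e′) e)) (Fin.toℕ<n i)) })
              (⟦⟧-yes (Level? (suc p) x) (x≢c ,
                ℕ.≤-antisym (bounded x≢c) (subst (suc p ≤_) (sym e) (s≤s (ℕ.≮⇒≥ j≮p)))))
      cases : Dec (x ≡ c) → ⟦ x Fin.≟ c ⟧ + low x + ⟦ Level? (suc p) x ⟧ ≡ 1
      cases (yes x≡c) = cong₂ _+_ (cong₂ _+_ (⟦⟧-yes (x Fin.≟ c) x≡c)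
        (low≡0 λ { _ (x≢c , _) → x≢c x≡c })) (⟦⟧-no (Level? (suc p) x) λ { (x≢c , _) → x≢c x≡c })
      cases (no x≢c) = trans (cong (λ z → z + low x + ⟦ Level? (suc p) x ⟧) (⟦⟧-no (x Fin.≟ c) x≢c))
        (sizes x≢c (s x) refl)

  -- With both sides moved so that no subtraction occurs: the number of ℓ with
  -- legLength ℓ ≡ a depends only on # Pendant? and # Long?.
  #legLength : ∀ a → # (λ ℓ → legLength ℓ ≟ a) + (# Pendant? * ⟦ 0 ≟ a ⟧ + # Long? * ⟦ p ≟ a ⟧) ≡
                     n * ⟦ 0 ≟ a ⟧ + (# Pendant? * ⟦ p ≟ a ⟧ + # Long? * ⟦ suc p ≟ a ⟧)
  #legLength a = trans (combine (λ ℓ → ⟦ legLength ℓ ≟ a ⟧) ⟦ 0 ≟ a ⟧ ⟦ p ≟ a ⟧)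
    (trans (sum-cong-≗ pt) (trans (sym (combine (λ _ → ⟦ 0 ≟ a ⟧) ⟦ p ≟ a ⟧ ⟦ suc p ≟ a ⟧))
      (cong (_+ (# Pendant? * ⟦ p ≟ a ⟧ + # Long? * ⟦ suc p ≟ a ⟧)) (sum-const n ⟦ 0 ≟ a ⟧))))
    where
    combine : ∀ (h : Fin n → ℕ) y z → sum h + (# Pendant? * y + # Long? * z) ≡
              sum (λ ℓ → h ℓ + (⟦ Pendant? ℓ ⟧ * y + ⟦ Long? ℓ ⟧ * z))
    combine h y z = sym (trans (∑-distrib-+ h (λ ℓ → ⟦ Pendant? ℓ ⟧ * y + ⟦ Long? ℓ ⟧ * z))
      (cong (sum h +_) (trans (∑-distrib-+ (λ ℓ → ⟦ Pendant? ℓ ⟧ * y) (λ ℓ → ⟦ Long? ℓ ⟧ * z))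
        (cong₂ _+_ (sym (*-distribʳ-sum y (λ ℓ → ⟦ Pendant? ℓ ⟧)))
                   (sym (*-distribʳ-sum z (λ ℓ → ⟦ Long? ℓ ⟧)))))))
    pt : ∀ ℓ → ⟦ legLength ℓ ≟ a ⟧ + (⟦ Pendant? ℓ ⟧ * ⟦ 0 ≟ a ⟧ + ⟦ Long? ℓ ⟧ * ⟦ p ≟ a ⟧) ≡
               ⟦ 0 ≟ a ⟧ + (⟦ Pendant? ℓ ⟧ * ⟦ p ≟ a ⟧ + ⟦ Long? ℓ ⟧ * ⟦ suc p ≟ a ⟧)
    pt ℓ = cases (Pendant? ℓ) (Long? ℓ)
      where
      Balance : ℕ → ℕ → Set
      Balance i j = ⟦ p * i + j ≟ a ⟧ + (i * ⟦ 0 ≟ a ⟧ + j * ⟦ p ≟ a ⟧) ≡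
                    ⟦ 0 ≟ a ⟧ + (i * ⟦ p ≟ a ⟧ + j * ⟦ suc p ≟ a ⟧)
      none : Balance 0 0
      none rewrite ℕ.*-zeroʳ p = refl
      short : Balance 1 0
      short rewrite ℕ.*-identityʳ p | ℕ.+-identityʳ p = lem ⟦ p ≟ a ⟧ ⟦ 0 ≟ a ⟧
        where
        lem : ∀ y z → y + (1 * z + 0) ≡ z + (1 * y + 0)
        lem = solve-∀
      long : Balance 1 1
      long rewrite ℕ.*-identityʳ p | ℕ.+-comm p 1 = lem ⟦ suc p ≟ a ⟧ ⟦ p ≟ a ⟧ ⟦ 0 ≟ a ⟧
        where
        lem : ∀ x y z → x + (1 * z + 1 * y) ≡ z + (1 * y + 1 * x)
        lem = solve-∀
      cases : Dec (Pendant ℓ) → Dec (Long ℓ) → Balance ⟦ Pendant? ℓ ⟧ ⟦ Long? ℓ ⟧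
      cases (no ¬pℓ) _ = subst₂ Balance (sym (⟦⟧-no (Pendant? ℓ) ¬pℓ))
        (sym (⟦⟧-no (Long? ℓ) λ { (_ , _ , pℓ , _) → ¬pℓ pℓ })) none
      cases (yes pℓ) (no ¬long) = subst₂ Balance (sym (⟦⟧-yes (Pendant? ℓ) pℓ))
        (sym (⟦⟧-no (Long? ℓ) ¬long)) short
      cases (yes pℓ) (yes l) = subst₂ Balance (sym (⟦⟧-yes (Pendant? ℓ) pℓ))
        (sym (⟦⟧-yes (Long? ℓ) l)) long

-- Isomorphisms between spiders

permutation-injective : ∀ {n} (π : Permutation n n) {i j} → π ⟨$⟩ʳ i ≡ π ⟨$⟩ʳ j → i ≡ j
permutation-injective π e = trans (sym (Perm.inverseˡ π)) (trans (cong (π ⟨$⟩ˡ_) e) (Perm.inverseˡ π))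

module LegMap {n p} (S S′ : SpiderTree n p) (π : Permutation n n)
  (π-legLength : ∀ ℓ → Legs.legLength S′ (π ⟨$⟩ʳ ℓ) ≡ Legs.legLength S ℓ) where

  private
    module S  = Legs S
    module S′ = Legs S′

  -- Centre goes to centre, and a vertex on the leg of `ℓ` to the one at the same position on the
  -- leg of `π ℓ`. As a relation it does not depend on the choice of `ℓ` and is easily inverted.
  Match : Fin n → Fin n → Set
  Match x y = (x ≡ S.c × y ≡ S′.c) ⊎
              (∃ λ ℓ → S.At x ℓ (S.s x) × S′.At y (π ⟨$⟩ʳ ℓ) (S.s x))

  match-total : ∀ x → ∃ (Match x)
  match-total x with x Fin.≟ S.c
  ... | yes x≡c = S′.c , inj₁ (x≡c , refl)
  ... | no  x≢c with S.pendant-below x≢c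
  ...   | ℓ , pℓ , xℓ with S′.≤legLength⇒at (S.s≥1 x)
                            (subst (S.s x ≤_) (sym (π-legLength ℓ)) (S.at⇒≤legLength (x≢c , pℓ , xℓ , refl)))
  ...     | y , at = y , inj₂ (ℓ , (x≢c , pℓ , xℓ , refl) , at)

  match-injective : ∀ {x x′ y} → Match x y → Match x′ y → x ≡ x′
  match-injective (inj₁ (refl , _)) (inj₁ (refl , _)) = refl
  match-injective (inj₁ (_ , refl)) (inj₂ (_ , _ , (y≢c , _))) = ⊥-elim (y≢c refl)
  match-injective (inj₂ (_ , _ , (y≢c , _))) (inj₁ (_ , refl)) = ⊥-elim (y≢c refl)
  match-injective (inj₂ (ℓ , (_ , _ , xℓ , _) , (y≢c , pℓ , yℓ , e)))
                  (inj₂ (ℓ′ , (_ , _ , x′ℓ′ , _) , (_ , pℓ′ , yℓ′ , e′)))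
    with refl ← permutation-injective π (S′.unique-pendant y≢c pℓ pℓ′ yℓ yℓ′)
    = S.s-injective-above xℓ x′ℓ′ (trans (sym e) e′)

  -- Away from the centre, consecutive positions on a leg stay consecutive. If `x` is the centre and
  -- `par v` were not, the leg of `π ℓ` would go on beyond `s u`; as the lengths agree, so would the
  -- leg of `ℓ`, and `par u` would not be the centre.
  match-child : ∀ {x u y v} → Match x y → Match u v → S.Child x u → S′.Child y v
  match-child _ (inj₁ (refl , _)) (u≢c , _) = ⊥-elim (u≢c refl)
  match-child {u = u} (inj₁ (refl , refl)) (inj₂ (ℓ , (u≢c , pℓ , uℓ , _) , (v≢c , pℓ′ , vℓ , e))) (_ , pu≡c) =
    v≢c , par-v
    where
    par-v : S′.par _ ≡ S′.c
    par-v with S′.par _ Fin.≟ S′.c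
    ... | yes pv≡c = pv≡c
    ... | no  pv≢c with S.≤legLength⇒at (s≤s z≤n) (subst (suc (S.s u) ≤_) (π-legLength ℓ)
                          (S′.at⇒≤legLength (pv≢c , pℓ′ , S′.⊑-trans (S′.par⊑ v≢c) vℓ ,
                            trans (S′.s-child pv≢c (v≢c , refl)) (cong suc e))))
    ...   | w , w≢c , _ , wℓ , sw = ⊥-elim (w≢c (trans (sym (S.par-above w≢c uℓ wℓ sw u≢c)) pu≡c))
  match-child {x} {u} (inj₂ (ℓ , (x≢c , pℓ , xℓ , _) , (y≢c , _ , yℓ , e)))
              (inj₂ (ℓ′ , (_ , pℓ′ , uℓ′ , _) , (v≢c , _ , vℓ′ , e′))) cu
    with refl ← S.unique-pendant x≢c pℓ pℓ′ xℓ (S.⊑-trans (S.child⊑ cu) uℓ′)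
    = v≢c , S′.par-above y≢c vℓ′ yℓ (trans e (trans (S.s-child x≢c cu) (cong suc (sym e′)))) v≢c

  match-adj : ∀ {x u y v} → Match x y → Match u v → Adj S.tree x u → Adj S′.tree y v
  match-adj xy uv xu with S.adj⇒par xu
  ... | inj₁ cu = S′.child⇒adj (match-child xy uv cu)
  ... | inj₂ cx = Adj-sym S′.tree (S′.child⇒adj (match-child uv xy cx))

  match-flip : ∀ {x y} → Match x y →
               (y ≡ S′.c × x ≡ S.c) ⊎
               (∃ λ ℓ → S′.At y ℓ (S′.s y) × S.At x (π ⟨$⟩ˡ ℓ) (S′.s y))
  match-flip (inj₁ (x≡c , y≡c)) = inj₁ (y≡c , x≡c)
  match-flip (inj₂ (ℓ , (x≢c , pℓ , xℓ , _) , (y≢c , pℓ′ , yℓ , e))) = inj₂ (π ⟨$⟩ʳ ℓ ,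
    (y≢c , pℓ′ , yℓ , refl) ,
    subst (λ z → S.At _ z _) (sym (Perm.inverseˡ π)) (x≢c , pℓ , xℓ , sym e))

spiders-isomorphic : ∀ {n p} (S S′ : SpiderTree n p) →
  # (SpiderTree.Pendant? S) ≡ # (SpiderTree.Pendant? S′) →
  SpiderTree.tree S ≅ SpiderTree.tree S′
spiders-isomorphic {n} {p} S S′ #P≡ = construct (colour-matching S.legLength S′.legLength #legLength≡)
  where
  module S  = Legs S
  module S′ = Legs S′
  #Long≡ : # S.Long? ≡ # S′.Long?
  #Long≡ = ℕ.+-cancelˡ-≡ (1 + p * # S.Pendant?) _ _ (trans (sym S.vertex-count)
    (trans S′.vertex-count (cong (λ z → 1 + p * z + # S′.Long?) (sym #P≡))))
  #legLength≡ : ∀ a → # (λ ℓ → S.legLength ℓ ≟ a) ≡ # (λ ℓ → S′.legLength ℓ ≟ a)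
  #legLength≡ a = ℕ.+-cancelʳ-≡ (# S.Pendant? * ⟦ 0 ≟ a ⟧ + # S.Long? * ⟦ p ≟ a ⟧) _ _
    (trans (S.#legLength a) (sym (trans
      (cong₂ (λ y z → # (λ ℓ → S′.legLength ℓ ≟ a) + (y * ⟦ 0 ≟ a ⟧ + z * ⟦ p ≟ a ⟧)) #P≡ #Long≡)
      (trans (S′.#legLength a)
        (cong₂ (λ y z → n * ⟦ 0 ≟ a ⟧ + (y * ⟦ p ≟ a ⟧ + z * ⟦ suc p ≟ a ⟧)) (sym #P≡) (sym #Long≡))))))
  construct : (∃ λ (π : Permutation n n) → ∀ ℓ → S′.legLength (π ⟨$⟩ʳ ℓ) ≡ S.legLength ℓ) →
              S.tree ≅ S′.tree
  construct (π , π-leg) = record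
    { bijection = Perm.permutation φ ψ φψ ψφ
    ; adjacency = λ u v → mk⇔
        (Fwd.match-adj (matchφ u) (matchφ v))
        (λ uv → subst₂ (Adj S.tree) (ψφ u) (ψφ v) (Bwd.match-adj (matchψ (φ u)) (matchψ (φ v)) uv))
    }
    where
    module Fwd = LegMap S S′ π π-leg
    module Bwd = LegMap S′ S (Perm.flip π)
      (λ ℓ → trans (sym (π-leg (π ⟨$⟩ˡ ℓ))) (cong S′.legLength (Perm.inverseʳ π)))
    φ ψ : Fin n → Fin n
    φ x = proj₁ (Fwd.match-total x)
    ψ y = proj₁ (Bwd.match-total y)
    matchφ : ∀ x → Fwd.Match x (φ x)
    matchφ x = proj₂ (Fwd.match-total x)
    matchψ : ∀ y → Bwd.Match y (ψ y)
    matchψ y = proj₂ (Bwd.match-total y)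
    -- `φ` and `ψ` come from independent choices; after a flip both matches have the same partner,
    -- and injectivity identifies the vertices.
    φψ : ∀ y → φ (ψ y) ≡ y
    φψ y = Bwd.match-injective (Fwd.match-flip (matchφ (ψ y))) (matchψ y)
    ψφ : ∀ x → ψ (φ x) ≡ x
    ψφ x = Fwd.match-injective (Bwd.match-flip (matchψ (φ x))) (matchφ x)

-- The extremal tree

-- Deleting c leaves m vertices which can be labelled 0, …, m ∸ 1 so that two
-- of them are adjacent exactly when their labels differ by k.
record ResidueLabelling {n} (G : Graph n) (c : Fin n) (m k : ℕ) : Set where
  field
    label            : Fin n → ℕ
    label<           : ∀ {u} → u ≢ c → label u < m
    label-injective  : ∀ {u v} → u ≢ c → v ≢ c → label u ≡ label v → u ≡ v
    label-surjective : ∀ {a} → a < m → ∃ λ u → u ≢ c × label u ≡ a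
    adj⇒label        : ∀ {u v} → u ≢ c → v ≢ c → Adj G u v →
                       label v ≡ label u + k ⊎ label u ≡ label v + k
    label⇒adj        : ∀ {u v} → u ≢ c → v ≢ c → label v ≡ label u + k → Adj G u v

module Labelled {n} (G : Graph n) (conn : Connected G) (acyclic : Acyclic G) (c : Fin n)
  {m k : ℕ} .{{_ : NonZero k}}
  (labelling : ResidueLabelling G c m k)
  (degree-c : degree G c ≡ k) (#Pendant≡k : # (RootedTree.Pendant? G conn acyclic c) ≡ k)
  where

  open RootedTree G conn acyclic c
  open ResidueLabelling labelling

  private
    p = (m ∸ 1) / k

  #Child≡k : # (Child? c) ≡ k
  #Child≡k = trans (#-cong (Child? c) (Adj? G c) (λ _ → child⇒adj) λ _ → to)
    (trans (sym (length-filter (Adj? G c))) degree-c)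
    where
    to : ∀ {w} → Adj G c w → Child c w
    to cw with adj⇒par cw
    ... | inj₁ cw′       = cw′
    ... | inj₂ (c≢c , _) = ⊥-elim (c≢c refl)

  private
    top-injective : ∀ {x x′ ℓ} → Child c x → Child c x′ → Pendant ℓ → x ⊑ ℓ → x′ ⊑ ℓ → x ≡ x′
    top-injective cx cx′ _ xℓ x′ℓ with comparable xℓ x′ℓ
    ... | inj₁ xx′ = children-incomparable cx cx′ xx′
    ... | inj₂ x′x = sym (children-incomparable cx′ cx x′x)

    -- The centre has `k` children and there are `k` pendant vertices, so this matching is tight:
    -- exactly one pendant vertex lies below each child.
    module Tops = Matching {R = _⊑_} (Child? c) Pendant? _⊑?_
      (λ cx → pendant-below (proj₁ cx)) top-injective

    tight : # Pendant? ≤ # (Child? c)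
    tight = ℕ.≤-reflexive (trans #Pendant≡k (sym #Child≡k))

  unique-pendant : UniquePendantBelow
  unique-pendant x≢c pℓ pℓ′ xℓ xℓ′ with top x≢c
  ... | y , cy , yx = Tops.functional tight cy pℓ pℓ′ (⊑-trans yx xℓ) (⊑-trans yx xℓ′)

  open Unbranched G conn acyclic c unique-pendant

  module Branch {x} (cx : Child c x) where

    private
      a = label x % k

    below≢c : ∀ {u} → x ⊑ u → u ≢ c
    below≢c xu refl = proj₁ cx (⊑c⇒≡ xu)

    -- An edge away from `c` shifts the label by `k`, so a branch stays in one residue class.
    residue : ∀ {u} → x ⊑ u → label u % k ≡ a
    residue here = refl
    residue (up {u} u≢c p) with adj⇒label u≢c (below≢c p) (adj-par u≢c)
    ... | inj₁ e = trans (sym (trans (cong (_% k) e) ([m+n]%n≡m%n (label u) k))) (residue p)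
    ... | inj₂ e = trans (trans (cong (_% k) e) ([m+n]%n≡m%n (label (par u)) k)) (residue p)

    -- Within a residue class the quotient by `k` determines the label, and labels are at most
    -- `m ∸ 1`, so only the quotients from 0 to `p` occur.
    size≤ : s x ≤ suc p
    size≤ = subst (s x ≤_) (trans (sum-const (suc p) 1) (ℕ.*-identityʳ (suc p)))
      (Matching.card-≤ {Q = λ _ → ⊤} {R = λ u j → label u / k ≡ toℕ j} (x ⊑?_) (λ (j : Fin (suc p)) → yes tt)
        (λ u j → label u / k ≟ toℕ j)
        (λ xu → fromℕ< (quotient< xu) , tt , sym (Fin.toℕ-fromℕ< (quotient< xu)))
        (λ xu xv _ e e′ → label-injective (below≢c xu) (below≢c xv)
          (same-label (trans (residue xu) (sym (residue xv))) (trans e (sym e′)))))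
      where
      quotient< : ∀ {u} → x ⊑ u → label u / k < suc p
      quotient< xu = s≤s (/-monoˡ-≤ k (ℕ.pred-mono-≤ (label< (below≢c xu))))
      same-label : ∀ {i j} → i % k ≡ j % k → i / k ≡ j / k → i ≡ j
      same-label {i} {j} e e′ = trans (m≡m%n+[m/n]*n i k)
        (trans (cong₂ (λ y z → y + z * k) e e′) (sym (m≡m%n+[m/n]*n j k)))

    step : ∀ {u v} → x ⊑ u → v ≢ c → Adj G u v → x ⊑ v
    step xu v≢c uv with adj⇒par uv
    ... | inj₁ cv = ⊑-trans xu (child⊑ cv)
    ... | inj₂ (u≢c , refl) with ⊑⇒≡⊎⊑par xu
    ...   | inj₁ refl    = ⊥-elim (v≢c (proj₂ cx))
    ...   | inj₂ (_ , p) = p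

    -- The branch is followed down to the smallest label of its class, from which `reach` climbs in
    -- steps of `k`. The form `a + 0` is `a + zero * k`, the start of that climb.
    lowest : ∀ t {u} → x ⊑ u → label u ≡ a + t * k → ∃ λ w → x ⊑ w × label w ≡ a + 0
    lowest zero    xu e = _ , xu , e
    lowest (suc t) {u} xu e with label-surjective {a + t * k} (ℕ.≤-<-trans
          (ℕ.≤-trans (ℕ.+-monoʳ-≤ a (ℕ.m≤n+m (t * k) k)) (ℕ.≤-reflexive (sym e))) (label< (below≢c xu)))
    ... | w , w≢c , e′ = lowest t (step xu w≢c (Adj-sym G (label⇒adj w≢c (below≢c xu)
            (trans e (trans (cong (a +_) (ℕ.+-comm k (t * k)))
              (trans (sym (ℕ.+-assoc a (t * k) k)) (cong (_+ k) (sym e′)))))))) e′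

    reach : ∀ t → a + t * k < m → ∃ λ w → x ⊑ w × label w ≡ a + t * k
    reach zero    _  = lowest (label x / k) here (m≡m%n+[m/n]*n (label x) k)
    reach (suc t) lt with reach t (ℕ.≤-<-trans (ℕ.+-monoʳ-≤ a (ℕ.m≤n+m (t * k) k)) lt)
                        | label-surjective lt
    ... | u , xu , e | w , w≢c , e′ = w , step xu w≢c (label⇒adj (below≢c xu) w≢c
            (trans e′ (trans (cong (a +_) (ℕ.+-comm k (t * k)))
              (trans (sym (ℕ.+-assoc a (t * k) k)) (cong (_+ k) (sym e)))))) , e′

    size≥ : p ≤ s x
    size≥ = subst (_≤ s x) (trans (sum-const p 1) (ℕ.*-identityʳ p))
      (Matching.card-≤ {P = λ _ → ⊤} {R = λ j u → label u ≡ a + toℕ j * k} (λ (j : Fin p) → yes tt) (x ⊑?_)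
        (λ j u → label u ≟ a + toℕ j * k)
        (λ {j} _ → reach (toℕ j) (inside j))
        (λ {i} {j} _ _ _ e e′ → Fin.toℕ-injective (ℕ.*-cancelʳ-≡ (toℕ i) (toℕ j) k
          (ℕ.+-cancelˡ-≡ a _ _ (trans (sym e) e′)))))
      where
      inside : ∀ (j : Fin p) → a + toℕ j * k < m
      inside j = ℕ.<-≤-trans (ℕ.+-monoˡ-< (toℕ j * k) (m%n<n (label x) k))
        (ℕ.≤-trans (ℕ.*-monoˡ-≤ k (Fin.toℕ<n j)) (ℕ.≤-trans (m/n*n≤m (m ∸ 1) k) (ℕ.m∸n≤m m 1)))

  bounded : ∀ {x} → x ≢ c → s x ≤ suc p
  bounded x≢c with top x≢c
  ... | y , cy , yx = ℕ.≤-trans (s-mono yx) (Branch.size≤ cy)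

  -- The branch containing a given pendant vertex has at least `p` vertices, and sizes drop by one
  -- along it, so each size up to `p` occurs there; its unique pendant vertex is the given one.
  full : ∀ {j} → j < p → # Pendant? ≤ # (Level? (suc j))
  full {j} j<p = Matching.card-≤ {R = λ ℓ x → x ⊑ ℓ} Pendant? (Level? (suc j)) (λ ℓ x → x ⊑? ℓ) total
    (λ { pℓ pℓ′ (x≢c , _) → unique-pendant x≢c pℓ pℓ′ })
    where
    total : ∀ {ℓ} → Pendant ℓ → ∃ λ x → Level (suc j) x × x ⊑ ℓ
    total pℓ with Tops.surjective tight pℓ
    ... | x , cx , xℓ with descendant-of-size (suc j) (proj₁ cx) (s≤s z≤n) (ℕ.≤-trans j<p (Branch.size≥ cx))
    ...   | w , xw , w≢c , sw with pendant-below w≢c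
    ...     | ℓ′ , pℓ′ , wℓ′ with refl ← unique-pendant (proj₁ cx) pℓ pℓ′ xℓ (⊑-trans xw wℓ′)
      = w , (w≢c , sw) , wℓ′

module _ {m k′ : ℕ} (2≤k : 2 ≤ suc k′) (k<m : suc k′ < m) where

  open Existence.Spider m k′ 2≤k k<m
    using (k; Par; H; A; B; val; val<m; val-inj; AdjH⇔; step→; step←; encode; child; par-child)

  -- The numbering `val` of the vertices of `H` is pulled back along the isomorphism: one step along
  -- a path of `H` raises `val` by `k`.
  spider-labelling : (G : Graph (suc m)) (c : Fin (suc m)) → G ∖ c ≅ H → ResidueLabelling G c m k
  spider-labelling G c iso = record
    { label            = label
    ; label<           = λ {u} u≢c → subst (_< m) (sym (label≡ u≢c)) (val<m (cell (punchOut (u≢c ∘ sym))))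
    ; label-injective  = λ u≢c v≢c e → Fin.punchOut-injective (u≢c ∘ sym) (v≢c ∘ sym)
                           (code-injective (trans (sym (label≡ u≢c)) (trans e (label≡ v≢c))))
    ; label-surjective = surjective
    ; adj⇒label        = adj⇒
    ; label⇒adj        = ⇒adj
    }
    where
    open _≅_ iso
    cell : Fin m → Fin A ⊎ Fin B
    cell i = splitAt A (bijection ⟨$⟩ʳ i)
    code : Fin m → ℕ
    code i = val (cell i)
    code-injective : ∀ {i j} → code i ≡ code j → i ≡ j
    code-injective {i} {j} e = trans (sym (Perm.inverseˡ bijection)) (trans (cong (bijection ⟨$⟩ˡ_)
      (trans (sym (Fin.join-splitAt A B (bijection ⟨$⟩ʳ i)))
        (trans (cong (join A B) (val-inj (cell i) (cell j) e)) (Fin.join-splitAt A B (bijection ⟨$⟩ʳ j)))))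
      (Perm.inverseˡ bijection))
    label : Fin (suc m) → ℕ
    label u with c Fin.≟ u
    -- A default at the centre, since all fields of the record concern the other vertices.
    ... | yes _   = 0
    ... | no  c≢u = code (punchOut c≢u)
    label≡ : ∀ {u} (u≢c : u ≢ c) → label u ≡ code (punchOut (u≢c ∘ sym))
    label≡ {u} u≢c with c Fin.≟ u
    ... | yes c≡u = ⊥-elim (u≢c (sym c≡u))
    ... | no  c≢u = cong code (Fin.punchOut-cong c refl)
    surjective : ∀ {a} → a < m → ∃ λ u → u ≢ c × label u ≡ a
    surjective {a} a<m with encode (fromℕ< a<m)
    ... | x , e = punchIn c i , Fin.punchInᵢ≢i c i ,
        trans (label≡ (Fin.punchInᵢ≢i c i)) (trans (cong code (Fin.punchOut-punchIn c))
          (trans (cong (val ∘ splitAt A) (Perm.inverseʳ bijection))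
            (trans (cong val (Fin.splitAt-join A B x)) (trans e (Fin.toℕ-fromℕ< a<m)))))
      where
      i : Fin m
      i = bijection ⟨$⟩ˡ join A B x
    adj≡ : ∀ {u v} (u≢c : u ≢ c) (v≢c : v ≢ c) →
           Adj (G ∖ c) (punchOut (u≢c ∘ sym)) (punchOut (v≢c ∘ sym)) ≡ Adj G u v
    adj≡ u≢c v≢c = cong₂ (Adj G) (Fin.punchIn-punchOut (u≢c ∘ sym)) (Fin.punchIn-punchOut (v≢c ∘ sym))
    at : ∀ {u} → u ≢ c → Fin A ⊎ Fin B
    at u≢c = cell (punchOut (u≢c ∘ sym))
    adj⇒ : ∀ {u v} → u ≢ c → v ≢ c → Adj G u v → label v ≡ label u + k ⊎ label u ≡ label v + k
    adj⇒ u≢c v≢c uv with Equivalence.to (AdjH⇔ (at u≢c) (at v≢c))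
        (Equivalence.to (adjacency _ _) (subst id (sym (adj≡ u≢c v≢c)) uv))
    -- `step→` uses labels with the centre at 0, hence `suc (val _)`; between nonzero labels `child`
    -- turns `Par` into a shift by `k`.
    ... | e , inj₁ pos = inj₁ (trans (label≡ v≢c) (trans (ℕ.suc-injective
            (child (s≤s z≤n) (step→ (at u≢c) (at v≢c) e pos))) (cong (_+ k) (sym (label≡ u≢c)))))
    ... | e , inj₂ pos = inj₂ (trans (label≡ u≢c) (trans (ℕ.suc-injective
            (child (s≤s z≤n) (step→ (at v≢c) (at u≢c) (sym e) pos))) (cong (_+ k) (sym (label≡ v≢c)))))
    ⇒adj : ∀ {u v} → u ≢ c → v ≢ c → label v ≡ label u + k → Adj G u v
    ⇒adj u≢c v≢c e = subst id (adj≡ u≢c v≢c) (Equivalence.from (adjacency _ _)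
      (Equivalence.from (AdjH⇔ (at u≢c) (at v≢c)) (proj₁ col-pos , inj₁ (proj₂ col-pos))))
      where
      val≡ : suc (val (at v≢c)) ≡ suc (val (at u≢c)) + k
      val≡ = cong suc (trans (sym (label≡ v≢c)) (trans e (cong (_+ k) (label≡ u≢c))))
      col-pos = step← (at u≢c) (at v≢c)
        (subst (Par (suc (val (at u≢c)))) (sym val≡) (par-child (suc (val (at u≢c)))))

-- Comparison of an arbitrary tree with the extremal tree

module _ {m k′ : ℕ} (2≤k : 2 ≤ suc k′) (k<m : suc k′ < m) where

  private
    n = suc m
    k = suc k′
    p = (m ∸ 1) / k

    k≤m-1 : k ≤ m ∸ 1
    k≤m-1 = ℕ.<⇒≤pred k<m

    1≤p : 1 ≤ p
    1≤p = m≥n⇒m/n>0 k≤m-1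

    -- As `2 ≤ k`, twice `p` is at most `p * k ≤ n ∸ 2`. This keeps the size `p + 1` within the
    -- increasing range of `f`.
    2+2p≤n : 2 * suc p ≤ n
    2+2p≤n = begin
      2 * suc p     ≡⟨ ℕ.*-comm 2 (suc p) ⟩
      2 + p * 2     ≤⟨ ℕ.+-monoʳ-≤ 2 (ℕ.*-monoʳ-≤ p 2≤k) ⟩
      2 + p * k     ≤⟨ ℕ.+-monoʳ-≤ 2 (m/n*n≤m (m ∸ 1) k) ⟩
      2 + (m ∸ 1)   ≡⟨ cong suc (ℕ.m+[n∸m]≡n (ℕ.≤-trans (s≤s z≤n) k<m)) ⟩
      n             ∎
      where open ℕ.≤-Reasoning

    f : ℕ → ℕ
    f a = a * (n ∸ a)

    τ = f (suc p)

    -- With `# Pendant?` replaced by `k` the compensation is literally the same number for both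
    -- trees.
    Gap : ℕ
    Gap = sum {p} λ i → (τ ∸ f (suc (toℕ i))) * k

    module Tree (T : 𝔗 n k) (c : Fin n) where
      open 𝔗 T public using (connected; acyclic)
      open RootedTree (graph T) connected acyclic c public using (Centroid; Pendant?)
      module Bnd = Bound (graph T) connected acyclic c p 2+2p≤n
      open Bnd public using (Balanced)

      #Pendant≡k : # Pendant? ≡ k
      #Pendant≡k = trans (sym (length-filter Pendant?)) (𝔗.pendant T)

      Gap≡ : Bnd.Gap ≡ Gap
      Gap≡ = sum-cong-≗ λ i → cong (Bnd.gap i *_) #Pendant≡k

      lower : Centroid → n * τ ≤ W T + Gap + τ
      lower cen = subst (λ z → n * τ ≤ W T + z + τ) Gap≡ (Bnd.wiener-lower cen)

      tight : Centroid → W T + Gap + τ ≤ n * τ → Balanced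
      tight cen le = Bnd.wiener⇒balanced cen (subst (λ z → W T + z + τ ≤ n * τ) (sym Gap≡) le)

      exact : Balanced → W T + Gap + τ ≡ n * τ
      exact bal = trans (cong (λ z → W T + z + τ) (sym Gap≡)) (Bnd.balanced⇒wiener bal)

      spider : Balanced → SpiderTree n p
      spider (bounded , full) = record
        { tree = graph T ; connected = connected ; acyclic = acyclic ; centre = c
        ; 1≤p = 1≤p ; bounded = bounded ; full = full }

    isT⇒balanced : (T : 𝔗 n k) → IsT n k T → ∃ (Tree.Balanced T)
    isT⇒balanced T (c , degree-c , iso) = c , L.bounded , L.full
      where
      module T = Tree T c
      module L = Labelled (graph T) T.connected T.acyclic c
        (spider-labelling 2≤k k<m (graph T) c iso) degree-c T.#Pendant≡k

    balanced-isomorphic : (T T′ : 𝔗 n k) → ∃ (Tree.Balanced T) → ∃ (Tree.Balanced T′) →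
                          graph T ≅ graph T′
    balanced-isomorphic T T′ (c , b) (c′ , b′) = spiders-isomorphic
      (Tree.spider T c b) (Tree.spider T′ c′ b′)
      (trans (Tree.#Pendant≡k T c) (sym (Tree.#Pendant≡k T′ c′)))

  -- Both trees are measured against `n * τ`, which `Tₙₖ` attains and which bounds `T` at a
  -- centroid. Equal indices make that bound tight, so `T` is balanced too, and any two balanced
  -- trees are isomorphic.
  wiener-minimal : (Tₙₖ : 𝔗 n k) → IsT n k Tₙₖ → (T : 𝔗 n k) →
    W Tₙₖ ≤ W T × (W Tₙₖ ≡ W T ⇔ graph T ≅ graph Tₙₖ)
  wiener-minimal Tₙₖ isT T = below (centroid (graph T) (𝔗.connected T) (𝔗.acyclic T))
    where
    balanced = isT⇒balanced Tₙₖ isT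
    exact : W Tₙₖ + Gap + τ ≡ n * τ
    exact = Tree.exact Tₙₖ (proj₁ balanced) (proj₂ balanced)
    below : (∃ λ c → Tree.Centroid T c) → W Tₙₖ ≤ W T × (W Tₙₖ ≡ W T ⇔ graph T ≅ graph Tₙₖ)
    below (c , cen) =
      ℕ.+-cancelʳ-≤ Gap _ _ (ℕ.+-cancelʳ-≤ τ _ _ (subst (_≤ W T + Gap + τ) (sym exact) (Tree.lower T c cen))) ,
      mk⇔ (λ e → balanced-isomorphic T Tₙₖ
             (c , Tree.tight T c cen (ℕ.≤-reflexive (trans (cong (λ z → z + Gap + τ) (sym e)) exact))) balanced)
          (λ iso → sym (wiener-≅ (𝔗.connected T) (𝔗.connected Tₙₖ) iso))

theorem1p3 : ∀ (n k : ℕ) .{{_ : NonZero k}} → 2 ≤ k → k + 2 ≤ n →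
    (Tₙₖ : 𝔗 n k) → IsT n k Tₙₖ → (T : 𝔗 n k) →
    W Tₙₖ ≤ W T × (W Tₙₖ ≡ W T ⇔ graph T ≅ graph Tₙₖ)
theorem1p3 (suc m) (suc k′) 2≤k k+2≤n =
  wiener-minimal 2≤k (s≤s⁻¹ (subst (_≤ suc m) (ℕ.+-comm (suc k′) 2) k+2≤n))
theorem1p3 zero (suc _) _ ()
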